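{- Let $h\ge 1$ and let $G$ be a finite graph that does not have the complete graph $K_{h+1}$ as a minor, such that every prime factor of $|\operatorname{Aut}(G)|$ is greater than $\max\{\alpha_h,2\}$. Then $\operatorname{Aut}(G)$ is obtained from abelian groups by repeatedly taking direct products and wreath products.
   Context: Fix a constant $a\ge 1$ such that for every $h\ge 1$ every finite graph with no $K_{h+1}$-minor has average degree at most $a\cdot h\cdot\sqrt{\log h}$ (such a constant exists by Kostochka's theorem), and set $\alpha_h:=\lceil a\cdot h\cdot\sqrt{\log h}\rceil$. A graph $H$ is a minor of $G$ if there is a partition of $V(G)$ into sets inducing connected subgraphs such that $H$ is isomorphic to a subgraph of the graph obtained by contracting each part (two parts adjacent iff some edge joins them). "Repeated direct and wreath products of abelian groups" refers to the smallest class of groups containing all abelian groups and closed under direct products and under (permutational) wreath products $\Delta\wr\Phi$ with $\Delta$ in the class and $\Phi$ an abelian permutation group. -}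

module Defs where

open import Level using (0ℓ)
open import Data.Nat using (ℕ; suc; _+_; _*_; _≤_)
open import Data.Bool using (Bool; true; false; not; if_then_else_)
open import Data.Fin using (Fin; _≟_)
open import Data.List using (List; map; allFin)
open import Data.Nat.ListAction using (sum)
open import Data.Product using (Σ; ∃; _×_; _,_; proj₁; proj₂)
open import Relation.Nullary using (¬_; yes; no)
open import Relation.Nullary.Decidable using (⌊_⌋)
open import Relation.Binary.PropositionalEquality as ≡
  using (_≡_; _≢_; refl; cong; cong₂)
open import Algebra.Bundles using (Group; RawGroup)
open import Algebra.Definitions using (Commutative)
open import Algebra.Morphism.Structures using (module GroupMorphisms)
import Algebra.Construct.DirectProduct as DP
import Algebra.Properties.Group as GP
open import Data.Fin.Permutation as Perm using (Permutation′; _⟨$⟩ʳ_; _⟨$⟩ˡ_)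

record Graph (n : ℕ) : Set where
  field
    adj    : Fin n → Fin n → Bool
    sym    : ∀ u v → adj u v ≡ adj v u
    irrefl : ∀ u → adj u u ≡ false

open Graph public

private
  ≟-sym : ∀ {m} (a b : Fin m) → ⌊ a ≟ b ⌋ ≡ ⌊ b ≟ a ⌋
  ≟-sym a b with a ≟ b | b ≟ a
  ... | yes _ | yes _ = refl
  ... | no _  | no _  = refl
  ... | yes p | no q  = Data.Empty.⊥-elim (q (≡.sym p)) where import Data.Empty
  ... | no p  | yes q = Data.Empty.⊥-elim (p (≡.sym q)) where import Data.Empty

  ≟-refl : ∀ {m} (a : Fin m) → ⌊ a ≟ a ⌋ ≡ true
  ≟-refl a with a ≟ a
  ... | yes _ = refl
  ... | no q  = Data.Empty.⊥-elim (q refl) where import Data.Empty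

K : (m : ℕ) → Graph m
K m = record
  { adj    = λ a b → not ⌊ a ≟ b ⌋
  ; sym    = λ a b → cong not (≟-sym a b)
  ; irrefl = λ a → cong not (≟-refl a)
  }

-- Reach G P u v : there is a walk from u to v in G all of whose vertices
-- after u satisfy P (used with u satisfying P: walk inside the induced
-- subgraph on {w | P w}).
data Reach {n : ℕ} (G : Graph n) (P : Fin n → Set) : Fin n → Fin n → Set where
  here : ∀ {u} → Reach G P u u
  step : ∀ {u w v} → adj G u w ≡ true → P w → Reach G P w v → Reach G P u v

-- H is a minor of G: a partition of V(G) into k nonempty parts (given by
-- π : Fin n → Fin k, surjective) each inducing a connected subgraph, and
-- an injective map ι from V(H) to the parts sending edges of H to edges
-- of the contracted graph (distinct parts joined by an edge of G).
record HasMinor {k′ n : ℕ} (H : Graph k′) (G : Graph n) : Set where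
  field
    k         : ℕ
    π         : Fin n → Fin k
    nonempty  : ∀ i → ∃ λ v → π v ≡ i
    connected : ∀ u v → π u ≡ π v → Reach G (λ w → π w ≡ π u) u v
    ι         : Fin k′ → Fin k
    ι-inj     : ∀ a b → ι a ≡ ι b → a ≡ b
    ι-edge    : ∀ a b → adj H a b ≡ true →
                ι a ≢ ι b ×
                (∃ λ u → ∃ λ v → adj G u v ≡ true × π u ≡ ι a × π v ≡ ι b)

deg : ∀ {n} → Graph n → Fin n → ℕ
deg {n} G v = sum (map (λ u → if adj G v u then 1 else 0) (allFin n))

degSum : ∀ {n} → Graph n → ℕ
degSum {n} G = sum (map (deg G) (allFin n))

-- α h bounds the average degree of every K_{h+1}-minor-free finite graph
-- (average degree ≤ α h  ⇔  sum of degrees ≤ α h · |V|).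
KostochkaBound : (ℕ → ℕ) → Set
KostochkaBound α = ∀ h → 1 ≤ h → ∀ n (G : Graph n) →
  ¬ HasMinor (K (suc h)) G → degSum G ≤ α h * n

record Auto {n : ℕ} (G : Graph n) : Set where
  field
    perm     : Permutation′ n
    preserve : ∀ u v → adj G (perm ⟨$⟩ʳ u) (perm ⟨$⟩ʳ v) ≡ adj G u v

open Auto public

Aut : ∀ {n} → Graph n → Group 0ℓ 0ℓ
Aut {n} G = record
  { Carrier = Auto G
  ; _≈_ = λ σ τ → ∀ u → perm σ ⟨$⟩ʳ u ≡ perm τ ⟨$⟩ʳ u
  ; _∙_ = λ σ τ → record
      { perm = Perm._∘ₚ_ (perm τ) (perm σ)
      ; preserve = λ u v → ≡.trans (preserve σ _ _) (preserve τ u v) }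
  ; ε = record { perm = Perm.id ; preserve = λ _ _ → refl }
  ; _⁻¹ = inv
  ; isGroup = record
    { isMonoid = record
      { isSemigroup = record
        { isMagma = record
          { isEquivalence = record
            { refl = λ _ → refl
            ; sym = λ p u → ≡.sym (p u)
            ; trans = λ p q u → ≡.trans (p u) (q u) }
          ; ∙-cong = λ {σ} {σ′} {τ} {τ′} p q u →
              ≡.trans (cong (perm σ ⟨$⟩ʳ_) (q u)) (p _) }
        ; assoc = λ _ _ _ _ → refl }
      ; identity = (λ _ _ → refl) , (λ _ _ → refl) }
    ; inverse = (λ σ u → Perm.inverseˡ (perm σ)) , (λ σ u → Perm.inverseʳ (perm σ))
    ; ⁻¹-cong = λ {σ} {τ} p u →
        ≡.trans (≡.sym (Perm.inverseˡ (perm τ)))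
          (cong (perm τ ⟨$⟩ˡ_)
            (≡.trans (≡.sym (p _)) (Perm.inverseʳ (perm σ))))
    }
  }
  where
  inv : Auto G → Auto G
  inv σ = record
    { perm = Perm.flip (perm σ)
    ; preserve = λ u v → ≡.trans
        (≡.sym (preserve σ (perm σ ⟨$⟩ˡ u) (perm σ ⟨$⟩ˡ v)))
        (cong₂ (adj G) (Perm.inverseʳ (perm σ)) (Perm.inverseʳ (perm σ)))
    }

record PermAction (Φ : Group 0ℓ 0ℓ) (Ω : Set) : Set where
  open Group Φ
  field
    act      : Carrier → Ω → Ω
    act-cong : ∀ {x y} → x ≈ y → ∀ ω → act x ω ≡ act y ω
    act-ε    : ∀ ω → act ε ω ≡ ω
    act-∙    : ∀ x y ω → act (x ∙ y) ω ≡ act x (act y ω)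
    faithful : ∀ {x y} → (∀ ω → act x ω ≡ act y ω) → x ≈ y

-- Permutational wreath product Δ ≀_Ω Φ = Δ^Ω ⋊ Φ, with
-- (f , x) (g , y) = (ω ↦ f ω · g (x⁻¹ ω) , x y).
Wreath : (Δ Φ : Group 0ℓ 0ℓ) (Ω : Set) → PermAction Φ Ω → Group 0ℓ 0ℓ
Wreath Δ Φ Ω A = record
  { Carrier = (Ω → D.Carrier) × F.Carrier
  ; _≈_ = λ { (f , x) (g , y) → (∀ ω → f ω D.≈ g ω) × x F.≈ y }
  ; _∙_ = mul
  ; ε = (λ _ → D.ε) , F.ε
  ; _⁻¹ = λ { (f , x) → (λ ω → f (act x ω) D.⁻¹) , x F.⁻¹ }
  ; isGroup = record
    { isMonoid = record
      { isSemigroup = record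
        { isMagma = record
          { isEquivalence = record
            { refl = (λ _ → D.refl) , F.refl
            ; sym = λ { (p , q) → (λ ω → D.sym (p ω)) , F.sym q }
            ; trans = λ { (p , q) (p′ , q′) → (λ ω → D.trans (p ω) (p′ ω)) , F.trans q q′ } }
          ; ∙-cong = λ { {f , x} {f′ , x′} {g , y} {g′ , y′} (p , q) (p′ , q′) →
              (λ ω → D.∙-cong (p ω)
                 (D.trans (D.reflexive (cong g (act-cong (F.⁻¹-cong q) ω)))
                          (p′ _)))
              , F.∙-cong q q′ } }
        ; assoc = λ { (f , x) (g , y) (k , z) →
            (λ ω → D.trans (D.assoc _ _ _)
              (D.∙-congˡ (D.∙-congˡ (D.reflexive (cong k (inv-∙ x y ω))))))
            , F.assoc x y z } }
      ; identity =
          (λ { (f , x) → (λ ω → D.trans (D.identityˡ _) (D.reflexive (cong f (act-ε⁻¹ ω))))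
                        , F.identityˡ x })
        , (λ { (f , x) → (λ ω → D.identityʳ _) , F.identityʳ x }) }
    ; inverse =
        (λ { (f , x) → (λ ω → D.trans
               (D.∙-congˡ (D.reflexive (cong f (act-cong (FP.⁻¹-involutive x) ω))))
               (D.inverseˡ _))
             , F.inverseˡ x })
      , (λ { (f , x) → (λ ω → D.trans
               (D.∙-congˡ (D.⁻¹-cong (D.reflexive (cong f (act-x-x⁻¹ x ω)))))
               (D.inverseʳ _))
             , F.inverseʳ x })
    ; ⁻¹-cong = λ { {f , x} {g , y} (p , q) →
        (λ ω → D.⁻¹-cong (D.trans (D.reflexive (cong f (act-cong q ω))) (p _)))
        , F.⁻¹-cong q }
    }
  }
  where
  module D = Group Δ
  module F = Group Φ
  module FP = GP Φ
  open PermAction A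

  mul : (Ω → D.Carrier) × F.Carrier → (Ω → D.Carrier) × F.Carrier →
        (Ω → D.Carrier) × F.Carrier
  mul (f , x) (g , y) = (λ ω → f ω D.∙ g (act (x F.⁻¹) ω)) , x F.∙ y

  inv-∙ : ∀ x y ω → act ((x F.∙ y) F.⁻¹) ω ≡ act (y F.⁻¹) (act (x F.⁻¹) ω)
  inv-∙ x y ω = ≡.trans (act-cong (FP.⁻¹-anti-homo-∙ x y) ω) (act-∙ _ _ ω)

  act-ε⁻¹ : ∀ ω → act (F.ε F.⁻¹) ω ≡ ω
  act-ε⁻¹ ω = ≡.trans (act-cong FP.ε⁻¹≈ε ω) (act-ε ω)

  act-x-x⁻¹ : ∀ x ω → act x (act (x F.⁻¹) ω) ≡ ω
  act-x-x⁻¹ x ω = ≡.trans (≡.sym (act-∙ x (x F.⁻¹) ω))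
    (≡.trans (act-cong (F.inverseʳ x) ω) (act-ε ω))

_≅_ : Group 0ℓ 0ℓ → Group 0ℓ 0ℓ → Set
G ≅ H = ∃ λ (f : Group.Carrier G → Group.Carrier H) →
  GroupMorphisms.IsGroupIsomorphism (Group.rawGroup G) (Group.rawGroup H) f

data RepeatedDirectWreath : Group 0ℓ 0ℓ → Set₁ where
  abelian : ∀ {G} → Commutative (Group._≈_ G) (Group._∙_ G) →
            RepeatedDirectWreath G
  direct  : ∀ {A B} → RepeatedDirectWreath A → RepeatedDirectWreath B →
            RepeatedDirectWreath (DP.group A B)
  wreath  : ∀ {Δ} → RepeatedDirectWreath Δ →
            (Φ : Group 0ℓ 0ℓ) → Commutative (Group._≈_ Φ) (Group._∙_ Φ) →
            (Ω : Set) (A : PermAction Φ Ω) →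
            RepeatedDirectWreath (Wreath Δ Φ Ω A)
  iso     : ∀ {G H} → RepeatedDirectWreath G → G ≅ H → RepeatedDirectWreath H

{-# OPTIONS --safe #-}
-- Write m = |Aut G|; every prime divisor of m exceeds α, so an orbit of a cyclic
-- subgroup, on vertices or on the branch sets of an invariant minor, is trivial or
-- has more than α elements, while no minor of G has minimum degree above α.
--
-- For a set S of vertices let Γ(S) be the pointwise stabiliser of its complement; the
-- claim is proved for all Γ(S) by induction on |S|. Components of G[S] are not moved,
-- since exchanging two of them would be an involution; so assume that G[S] is connected.
-- In an invariant minor, adjacent vertices have comparable stabilisers: otherwise both
-- would have more than α neighbours. Hence, if b ∈ S has a maximal stabiliser K, then S
-- retracts equivariantly, with connected fibres, onto the orbit of b. In the connected
-- graph of these fibres K fixes the neighbours of whatever it fixes, so K acts trivially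
-- on the orbit. The quotient Γ(S)/K is abelian: if s moves b to a neighbour, then ⟨s⟩K is
-- normal, and contracting S further onto the orbit of b under ⟨s⟩ gives a Cayley graph of
-- a cyclic group in which the conjugates of s by the powers of any t are connection
-- elements; as there are at most α of them, t commutes with s.
--
-- Finally let Rest be the set of vertices of S not fixed by K. A component D of G[Rest]
-- has stabiliser K in Γ(S), because contracting D onto a K-orbit would otherwise give a
-- complete bipartite minor with both sides larger than α. So if T is the union of
-- representatives of the Γ(S)-orbits of components, Γ(S) is the wreath product of Γ(T)
-- by the regular abelian group Γ(S)/K.
module Submission where

open import Defs hiding (sym)
open import Level using (0ℓ)
open import Data.Nat using (ℕ; zero; suc; _+_; _*_; _∸_; _^_; _≤_; _<_; _⊔_; z≤n; s≤s; NonZero;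
  nonZero)
open import Data.Nat.Properties using (≤-refl; ≤-trans; ≤-<-trans; <-irrefl; <⇒≤; m≤n⇒∃[o]m+o≡n;
  m≤n+m; +-comm; +-suc; +-identityʳ; +-mono-≤; *-comm; n≤1+n; n<1+n; m≤m⊔n; m≤n⊔m; ≤-pred; ≤-total;
  m+[n∸m]≡n; m∸n≤m; m≤n⇒m<n∨m≡n) renaming (_≟_ to _≟ℕ_)
open import Data.Nat.Divisibility using (_∣_; ∣⇒≤; ∣-trans; 0∣⇒≡0; m∣m*n)
open import Data.Nat.Primality using (Prime)
open import Data.Nat.Coprimality using (Coprime; coprime-Bézout)
open import Data.Nat.GCD using (module Bézout)
open import Data.Nat.DivMod using (_/_; _%_; m≡m%n+[m/n]*n; m%n<n)
open import Data.Nat.Induction using (<-wellFounded)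
open import Induction.WellFounded using (Acc; acc)
open import Data.Fin using (Fin; zero; suc; toℕ; fromℕ<; _≟_; finToFun; funToFin; combine; remQuot)
open import Data.Fin.Properties using (any?; all?; toℕ-injective; toℕ<n; toℕ-fromℕ<; injective⇒≤;
  suc-injective; finToFun-funToFin; funToFin-finToFin; remQuot-combine; combine-remQuot;
  pigeonhole)
open import Data.Fin.Permutation using (_⟨$⟩ʳ_; _⟨$⟩ˡ_; permutation; inverseˡ; inverseʳ; ↔⇒≡)
open import Data.Bool using (Bool; true; false; if_then_else_)
open import Data.Product using (∃; _×_; _,_; proj₁; proj₂)
open import Data.Sum using (_⊎_; inj₁; inj₂)
open import Data.Empty using (⊥; ⊥-elim)
open import Function using (_∘_)
open import Function.Bundles using (Inverse; mk⇔)
open import Relation.Nullary using (¬_; Dec; yes; no; does)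
open import Relation.Nullary.Decidable using (map′; _×-dec_; _⊎-dec_; _→-dec_; ¬?;
  decidable-stable; does-⇔; dec-true; dec-false)
open import Relation.Unary using (Decidable)
open import Relation.Binary using (Symmetric; Transitive)
open import Relation.Binary.PropositionalEquality using (_≡_; _≢_; refl; sym; trans; cong; cong₂;
  subst; setoid; module ≡-Reasoning)
open import Algebra.Bundles using (Group)
open import Data.Nat.ListAction using (sum)
open import Data.List using ([]; _∷_; map; length; allFin; tabulate)
open import Data.List.Properties using (length-tabulate)
import Algebra.Construct.DirectProduct as DP
import Algebra.Properties.Group as GP
open import Algebra.Definitions using (Commutative)
open import Data.Unit using (⊤; tt)
open import Data.Nat.Primality.Factorisation using (factorise)
open import Data.List.Relation.Unary.All using ([]; _∷_)
open import Algebra.Morphism.Structures using (module GroupMorphisms)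
import Data.Bool.Properties as Bool

-- Transversals, counting and maximal elements in finite sets.

Decidable₂ : ∀ {A : Set} → (A → A → Set) → Set
Decidable₂ R = ∀ x y → Dec (R x y)

-- R is a partial equivalence relation in the applications, so that only the
-- elements with R v v belong to a class.
record Transversal {n : ℕ} (R : Fin n → Fin n → Set) : Set where
  field
    size    : ℕ
    rep     : Fin size → Fin n
    rep-dom : ∀ i → R (rep i) (rep i)
    rep-inj : ∀ i j → R (rep i) (rep j) → i ≡ j
    covers  : ∀ v → R v v → ∃ λ i → R v (rep i)

-- Greedy choice by recursion on `n`: `zero` becomes a representative exactly when it lies in the
-- domain and is related to none of the representatives chosen among the other elements.
transversal : ∀ {n} (R : Fin n → Fin n → Set) → Decidable₂ R → Symmetric R → Transversal R
transversal {zero} R R? R-sym = record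
  { size = 0 ; rep = λ () ; rep-dom = λ () ; rep-inj = λ () ; covers = λ () }
transversal {suc n} R R? R-sym
  with transversal (λ i j → R (suc i) (suc j)) (λ i j → R? (suc i) (suc j)) R-sym
... | T with R? zero zero ×-dec ¬? (any? λ i → R? zero (suc (Transversal.rep T i)))
...   | yes (dom , new) = record
  { size = suc T.size ; rep = r ; rep-dom = d ; rep-inj = inj ; covers = c }
  where
  module T = Transversal T
  r : Fin (suc T.size) → Fin (suc n)
  r zero    = zero
  r (suc i) = suc (T.rep i)
  d : ∀ i → R (r i) (r i)
  d zero    = dom
  d (suc i) = T.rep-dom i
  inj : ∀ i j → R (r i) (r j) → i ≡ j
  inj zero    zero    _ = refl
  inj zero    (suc j) p = ⊥-elim (new (j , p))
  inj (suc i) zero    p = ⊥-elim (new (i , R-sym p))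
  inj (suc i) (suc j) p = cong suc (T.rep-inj i j p)
  c : ∀ v → R v v → ∃ λ i → R v (r i)
  c zero    _ = zero , dom
  c (suc v) p with T.covers v p
  ... | i , q = suc i , q
...   | no ¬new = record
  { size = T.size ; rep = suc ∘ T.rep ; rep-dom = T.rep-dom ; rep-inj = T.rep-inj ; covers = c }
  where
  module T = Transversal T
  c : ∀ v → R v v → ∃ λ i → R v (suc (T.rep i))
  c zero    p = decidable-stable (any? λ i → R? zero (suc (T.rep i))) λ none → ¬new (p , none)
  c (suc v) p = T.covers v p

count : ∀ {n} {P : Fin n → Set} → Decidable P → ℕ
count {zero}  P? = 0
count {suc n} P? = (if does (P? zero) then 1 else 0) + count (P? ∘ suc)

count-≤ : ∀ {n} {P Q : Fin n → Set} (P? : Decidable P) (Q? : Decidable Q) →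
          (∀ {v} → P v → Q v) → count P? ≤ count Q?
count-≤ {zero}  P? Q? sub = z≤n
count-≤ {suc n} P? Q? sub with P? zero | Q? zero
... | yes p | yes q = s≤s (count-≤ (P? ∘ suc) (Q? ∘ suc) sub)
... | yes p | no ¬q = ⊥-elim (¬q (sub p))
... | no ¬p | yes q = ≤-trans (count-≤ (P? ∘ suc) (Q? ∘ suc) sub) (n≤1+n _)
... | no ¬p | no ¬q = count-≤ (P? ∘ suc) (Q? ∘ suc) sub

count-< : ∀ {n} {P Q : Fin n → Set} (P? : Decidable P) (Q? : Decidable Q) →
          (∀ {v} → P v → Q v) → ∀ v → ¬ P v → Q v → count P? < count Q?
count-< {suc n} P? Q? sub zero ¬p q with P? zero | Q? zero
... | yes p | _     = ⊥-elim (¬p p)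
... | no _  | no ¬q = ⊥-elim (¬q q)
... | no _  | yes _ = s≤s (count-≤ (P? ∘ suc) (Q? ∘ suc) sub)
count-< {suc n} P? Q? sub (suc v) ¬p q with P? zero | Q? zero
... | yes _ | yes _ = s≤s (count-< (P? ∘ suc) (Q? ∘ suc) sub v ¬p q)
... | yes p | no ¬q = ⊥-elim (¬q (sub p))
... | no _  | yes _ = ≤-trans (count-< (P? ∘ suc) (Q? ∘ suc) sub v ¬p q) (n≤1+n _)
... | no _  | no _  = count-< (P? ∘ suc) (Q? ∘ suc) sub v ¬p q

-- Climb from `u` to some `w` strictly above it. The number of elements of `P` not below the current
-- one drops, since `w` itself is no longer counted.
maximal : ∀ {n} {P : Fin n → Set} (P? : Decidable P) (_⊑_ : Fin n → Fin n → Set) →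
          Decidable₂ _⊑_ → (∀ {u} → u ⊑ u) → (∀ {u v w} → u ⊑ v → v ⊑ w → u ⊑ w) →
          ∀ v → P v → ∃ λ b → P b × (∀ w → P w → b ⊑ w → w ⊑ b)
maximal {n} {P} P? _⊑_ ⊑? ⊑-refl ⊑-trans v pv = go v pv (<-wellFounded _)
  where
  above? : ∀ u → Decidable (λ w → P w × ¬ w ⊑ u)
  above? u w = P? w ×-dec ¬? (⊑? w u)
  go : ∀ u → P u → Acc _<_ (count (above? u)) → ∃ λ b → P b × (∀ w → P w → b ⊑ w → w ⊑ b)
  go u pu (acc rec) with any? (λ w → P? w ×-dec (⊑? u w ×-dec ¬? (⊑? w u)))
  ... | no none = u , pu , λ w pw u⊑w →
    decidable-stable (⊑? w u) λ ¬w⊑u → none (w , pw , u⊑w , ¬w⊑u)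
  ... | yes (w , pw , u⊑w , ¬w⊑u) = go w pw (rec (count-< (above? w) (above? u)
    (λ { (px , x⋢w) → px , λ x⊑u → x⋢w (⊑-trans x⊑u u⊑w) })
    w (λ { (_ , w⋢w) → w⋢w ⊑-refl }) (pw , ¬w⊑u)))

-- Cyclic orbits with a period free of small divisors.

-- By Bézout, multiples of `d` and of `m` differ by 1. Both satisfy `P`, and cancelling one from the
-- other leaves `P 1`.
coprime-period : {P : ℕ → Set} → P 0 → (∀ {i j} → P i → P j → P (i + j)) →
                 (∀ {i j} → P (i + j) → P j → P i) →
                 ∀ {d m} → Coprime d m → P d → P m → P 1
coprime-period {P} P0 add cancel {d} {m} c Pd Pm = conclude (coprime-Bézout c)
  where
  multiple : ∀ {k} i → P k → P (i * k)
  multiple zero    p = P0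
  multiple (suc i) p = add p (multiple i p)
  conclude : Bézout.Identity 1 d m → P 1
  conclude (Bézout.+- x y eq) =
    cancel {1} {y * m} (subst P (sym eq) (multiple x Pd)) (multiple y Pm)
  conclude (Bézout.-+ x y eq) =
    cancel {1} {x * d} (subst P (sym eq) (multiple y Pm)) (multiple x Pd)

-- A repetition `a i ~ a (i + d)` with `0 < d ≤ β` shifts back to `a d ~ a 0`. As `d` is coprime to
-- the period `m`, the sequence would also have period 1, which is excluded.
distinct-orbit :
  ∀ {X : Set} (_~_ : X → X → Set) → Symmetric _~_ → Transitive _~_ →
  (a : ℕ → X) → (∀ i j → a i ~ a j → a (suc i) ~ a (suc j)) →
  (∀ i j → a (suc i) ~ a (suc j) → a i ~ a j) →
  ∀ m → a m ~ a 0 → ¬ a 1 ~ a 0 →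
  ∀ β → (∀ d → 1 ≤ d → d ≤ β → Coprime d m) →
  ∀ i j → i ≤ β → j ≤ β → a i ~ a j → i ≡ j
distinct-orbit {X} _~_ ~-sym ~-trans a fwd back m period move β coprime i j i≤β j≤β aiaj
  = conclude (≤-total i j)
  where
  shift : ∀ k {i j} → a i ~ a j → a (k + i) ~ a (k + j)
  shift zero    p = p
  shift (suc k) p = fwd _ _ (shift k p)
  unshift : ∀ k {i j} → a (k + i) ~ a (k + j) → a i ~ a j
  unshift zero    p = p
  unshift (suc k) p = unshift k (back _ _ p)
  P : ℕ → Set
  P k = a k ~ a 0
  add : ∀ {i j} → P i → P j → P (i + j)
  add {i} {j} p q = ~-trans (subst (λ k → a (i + j) ~ a k) (+-identityʳ i) (shift i q)) p
  cancel : ∀ {i j} → P (i + j) → P j → P i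
  cancel {i} {j} p q =
    ~-trans (~-sym (subst (λ k → a (i + j) ~ a k) (+-identityʳ i) (shift i q))) p
  ordered : ∀ i j → i ≤ j → j ≤ β → a i ~ a j → i ≡ j
  ordered i j i≤j j≤β p with m≤n⇒∃[o]m+o≡n i≤j
  ... | zero  , refl = sym (+-identityʳ i)
  ... | suc d , refl = ⊥-elim (move (coprime-period {P = P} (~-trans (~-sym period) period)
    (λ {i} {j} → add {i} {j}) (λ {i} {j} → cancel {i} {j})
    (coprime (suc d) (s≤s z≤n) (≤-trans (m≤n+m (suc d) i) j≤β))
    (~-sym (unshift i (subst (λ k → a k ~ a (i + suc d)) (sym (+-identityʳ i)) p))) period))
  conclude : i ≤ j ⊎ j ≤ i → i ≡ j
  conclude (inj₁ i≤j) = ordered i j i≤j j≤β aiaj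
  conclude (inj₂ j≤i) = sym (ordered j i j≤i i≤β (~-sym aiaj))

does⁻ : ∀ {A : Set} (a? : Dec A) → does a? ≡ true → A
does⁻ (yes a) _ = a

-- Walks.

module _ {n : ℕ} {G : Graph n} where

  reach-map : ∀ {P Q : Fin n → Set} → (∀ {w} → P w → Q w) →
              ∀ {u v} → Reach G P u v → Reach G Q u v
  reach-map f here         = here
  reach-map f (step e p r) = step e (f p) (reach-map f r)

  reach-trans : ∀ {P : Fin n → Set} {u v w} → Reach G P u v → Reach G P v w → Reach G P u w
  reach-trans here         s = s
  reach-trans (step e p r) s = step e p (reach-trans r s)

  -- Induction along a walk. All later arguments that spread a property through a connected set take
  -- this form.
  reach-closed : ∀ {P Q : Fin n → Set} →
                 (∀ {u w} → Q u → adj G u w ≡ true → P w → Q w) →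
                 ∀ {u v} → Q u → Reach G P u v → Q v
  reach-closed f q here         = q
  reach-closed f q (step e p r) = reach-closed f (f q e p) r

  reach-end : ∀ {P : Fin n → Set} {u v} → P u → Reach G P u v → P v
  reach-end = reach-closed λ _ _ p → p

  adj-sym : ∀ {u v} → adj G u v ≡ true → adj G v u ≡ true
  adj-sym {u} {v} e = trans (Graph.sym G v u) e

  reach-sym : ∀ {P : Fin n → Set} {u v} → P u → Reach G P u v → Reach G P v u
  reach-sym {P} {u} pu r = proj₂ (reach-closed {Q = λ w → P w × Reach G P w u}
    (λ { (pw , s) e px → px , step (adj-sym e) pw s }) (pu , here) r)

-- Lower bounds for degrees.

private
  indicators : ∀ {k} → (Fin k → Bool) → ℕ
  indicators {zero}  b = 0
  indicators {suc k} b = (if b zero then 1 else 0) + indicators (b ∘ suc)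

  sum-indicators : ∀ {k l} (g : Fin l → Fin k) (b : Fin k → Bool) →
    sum (map (λ u → if b u then 1 else 0) (tabulate g)) ≡ indicators (b ∘ g)
  sum-indicators {l = zero}  g b = refl
  sum-indicators {l = suc l} g b = cong (_ +_) (sum-indicators (g ∘ suc) b)

  -- The rank of `u` among the true entries of `b`. It embeds any family of distinct neighbours of a
  -- vertex into a finite set whose size is the degree.
  position : ∀ {k} (b : Fin k → Bool) u → b u ≡ true → Fin (indicators b)
  position b zero    p with b zero
  ... | true = zero
  position b (suc u) p with b zero
  ... | true  = suc (position (b ∘ suc) u p)
  ... | false = position (b ∘ suc) u p

  position-injective : ∀ {k} (b : Fin k → Bool) u v p q →
                       position b u p ≡ position b v q → u ≡ v
  position-injective b zero    zero    p q eq = refl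
  position-injective b zero    (suc v) p q eq with b zero
  position-injective b zero    (suc v) p q () | true
  position-injective b (suc u) zero    p q eq with b zero
  position-injective b (suc u) zero    p q () | true
  position-injective b (suc u) (suc v) p q eq with b zero
  ... | true  = cong suc (position-injective (b ∘ suc) u v p q (suc-injective eq))
  ... | false = cong suc (position-injective (b ∘ suc) u v p q eq)

  sum-≥ : ∀ {A : Set} (f : A → ℕ) c → (∀ x → c ≤ f x) → ∀ xs → length xs * c ≤ sum (map f xs)
  sum-≥ f c c≤f []       = z≤n
  sum-≥ f c c≤f (x ∷ xs) = +-mono-≤ (c≤f x) (sum-≥ f c c≤f xs)

deg-≥ : ∀ {k t} (Q : Graph k) v (nb : Fin t → Fin k) → (∀ {i j} → nb i ≡ nb j → i ≡ j) →
        (∀ i → adj Q v (nb i) ≡ true) → t ≤ deg Q v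
deg-≥ {k} Q v nb nb-inj nb-adj = subst (_ ≤_) (sym (sum-indicators (λ u → u) (adj Q v)))
  (injective⇒≤ {f = λ i → position (adj Q v) (nb i) (nb-adj i)}
    (λ eq → nb-inj (position-injective (adj Q v) _ _ _ _ eq)))

degSum-≥ : ∀ {k} (Q : Graph k) c → (∀ v → c ≤ deg Q v) → k * c ≤ degSum Q
degSum-≥ {k} Q c c≤deg = subst (λ l → l * c ≤ degSum Q) (length-tabulate {n = k} (λ u → u))
  (sum-≥ (deg Q) c c≤deg (allFin k))

-- Minors obtained by contracting connected classes.

-- The classes of R are the branch sets of the minor obtained by contracting
-- each of them and deleting every vertex outside the domain of R.
record ConnectedPER {n : ℕ} (G : Graph n) : Set₁ where
  field
    R       : Fin n → Fin n → Set
    R?      : Decidable₂ R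
    R-sym   : Symmetric R
    R-trans : Transitive R
    R-conn  : ∀ {u v} → R u v → Reach G (R u) u v

  domˡ : ∀ {u v} → R u v → R u u
  domˡ p = R-trans p (R-sym p)

  Adjacent : Fin n → Fin n → Set
  Adjacent u v = ¬ R u v × ∃ λ x → ∃ λ y → R u x × adj G x y ≡ true × R y v

module Contraction {n : ℕ} {G : Graph n} (C : ConnectedPER G) where
  open ConnectedPER C
  open Transversal (transversal R R? R-sym) public

  Edge : Fin size → Fin size → Set
  Edge i j = i ≢ j × ∃ λ x → ∃ λ y → R (rep i) x × adj G x y ≡ true × R y (rep j)

  Edge? : Decidable₂ Edge
  Edge? i j = ¬? (i ≟ j) ×-dec any? λ x → any? λ y →
    R? (rep i) x ×-dec ((adj G x y Bool.≟ true) ×-dec R? y (rep j))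

  Edge-sym : ∀ {i j} → Edge i j → Edge j i
  Edge-sym (i≢j , x , y , p , e , q) =
    (λ eq → i≢j (sym eq)) , y , x , R-sym q , adj-sym {G = G} e , R-sym p

  quotient : Graph size
  quotient = record
    { adj    = λ i j → does (Edge? i j)
    ; sym    = λ i j → does-⇔ (mk⇔ Edge-sym Edge-sym) (Edge? i j) (Edge? j i)
    ; irrefl = λ i → dec-false (Edge? i i) λ e → proj₁ e refl }

  lift-reach : ∀ {P : Fin size → Set} {i j} → P i → Reach quotient P i j →
               ∀ {u v} → R u (rep i) → R v (rep j) →
               Reach G (λ w → ∃ λ l → R w (rep l) × P l) u v
  lift-reach {i = i} pi here p q =
    reach-map (λ r → i , R-trans (R-sym r) p , pi) (R-conn (R-trans p (R-sym q)))
  lift-reach {i = i} pi (step {w = j} e pj r) p q with does⁻ (Edge? i j) e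
  ... | _ , x , y , px , exy , py = reach-trans
    (reach-map (λ r → i , R-trans (R-sym r) p , pi) (R-conn (R-trans p px)))
    (step exy (j , py , pj) (lift-reach pj r py q))

  -- Each part is replaced by the union of the classes in it. This union is connected by
  -- `lift-reach`, which follows a walk in the quotient, crossing each class inside that class.
  lift-minor : ∀ {k} {H : Graph k} → HasMinor H quotient → HasMinor H G
  lift-minor {H = H} M = record
    { k = T.size ; π = π ; nonempty = λ i → T.rep i , T.rep-inj _ _ (E-sym (π-E (T.rep i)))
    ; connected = λ u v eq → reach-map (λ e → sym (E⇒π e)) (E-conn (π⇒E eq))
    ; ι = ι′
    ; ι-inj = λ a b eq → M.ι-inj a b (same-part a b (π⇒E eq))
    ; ι-edge = edge }
    where
    module M = HasMinor M
    -- The vertices that are in no class of R become singleton parts.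
    E : Fin n → Fin n → Set
    E u v = u ≡ v ⊎ ∃ λ i → ∃ λ j → R u (rep i) × R v (rep j) × M.π i ≡ M.π j
    E? : Decidable₂ E
    E? u v = (u ≟ v) ⊎-dec any? λ i → any? λ j →
      R? u (rep i) ×-dec (R? v (rep j) ×-dec (M.π i ≟ M.π j))
    E-sym : Symmetric E
    E-sym (inj₁ refl) = inj₁ refl
    E-sym (inj₂ (i , j , p , q , eq)) = inj₂ (j , i , q , p , sym eq)
    E-trans : Transitive E
    E-trans (inj₁ refl) e = e
    E-trans e@(inj₂ _) (inj₁ refl) = e
    E-trans (inj₂ (i , j , p , q , eq)) (inj₂ (i′ , j′ , p′ , q′ , eq′)) =
      inj₂ (i , j′ , p , q′ , trans eq (trans (cong M.π (rep-inj j i′ (R-trans (R-sym q) p′))) eq′))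
    E-conn : ∀ {u v} → E u v → Reach G (E u) u v
    E-conn (inj₁ refl) = here
    E-conn (inj₂ (i , j , p , q , eq)) =
      reach-map (λ { (l , r , eq′) → inj₂ (i , l , p , r , sym eq′) })
        (lift-reach refl (M.connected i j eq) p q)
    module T = Transversal (transversal E E? E-sym)
    π : Fin n → Fin T.size
    π v = proj₁ (T.covers v (inj₁ refl))
    π-E : ∀ v → E v (T.rep (π v))
    π-E v = proj₂ (T.covers v (inj₁ refl))
    E⇒π : ∀ {u v} → E u v → π u ≡ π v
    E⇒π {u} {v} e = T.rep-inj _ _ (E-trans (E-sym (π-E u)) (E-trans e (π-E v)))
    π⇒E : ∀ {u v} → π u ≡ π v → E u v
    π⇒E {u} {v} eq = E-trans (π-E u) (subst (λ i → E (T.rep i) v) (sym eq) (E-sym (π-E v)))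
    pick : ∀ a → Fin size
    pick a = proj₁ (M.nonempty (M.ι a))
    ι′ : _ → Fin T.size
    ι′ a = π (rep (pick a))
    same-part : ∀ a b → E (rep (pick a)) (rep (pick b)) → M.ι a ≡ M.ι b
    same-part a b e = trans (sym (proj₂ (M.nonempty (M.ι a))))
                            (trans (same e) (proj₂ (M.nonempty (M.ι b))))
      where
      same : ∀ {i j} → E (rep i) (rep j) → M.π i ≡ M.π j
      same {i} {j} (inj₁ eq) = cong M.π (rep-inj i j (subst (R (rep i)) eq (rep-dom i)))
      same (inj₂ (i′ , j′ , p , q , eq)) =
        trans (cong M.π (rep-inj _ _ p)) (trans eq (cong M.π (sym (rep-inj _ _ q))))
    edge : ∀ a b → adj H a b ≡ true → ι′ a ≢ ι′ b ×
           ∃ λ u → ∃ λ v → adj G u v ≡ true × π u ≡ ι′ a × π v ≡ ι′ b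
    edge a b ab with M.ι-edge a b ab
    ... | a≢b , i , j , ij , pi , pj with does⁻ (Edge? i j) ij
    ...   | _ , x , y , px , exy , py =
      (λ eq → a≢b (same-part a b (π⇒E eq))) , x , y , exy ,
      E⇒π (inj₂ (i , pick a , R-sym px , rep-dom _ , trans pi (sym (proj₂ (M.nonempty (M.ι a)))))) ,
      E⇒π (inj₂ (j , pick b , py , rep-dom _ , trans pj (sym (proj₂ (M.nonempty (M.ι b))))))

-- No minor of G has minimum degree greater than α; the values nb i with i ≤ α are
-- representatives of distinct neighbours of the class of u.
NoDenseMinor : ∀ {n} → Graph n → ℕ → Set₁
NoDenseMinor {n} G α = (C : ConnectedPER G) → let open ConnectedPER C in
  (v : Fin n) → R v v →
  (∀ u → R u u → ∃ λ (nb : ℕ → Fin n) →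
    (∀ i → i ≤ α → Adjacent u (nb i)) × (∀ i j → i ≤ α → j ≤ α → R (nb i) (nb j) → i ≡ j)) → ⊥

-- Were all degrees in the contracted graph on `size` vertices above `α h`, the degree sum would be
-- at least `size * suc (α h)`, against the bound `α h * size`. The class of `v` ensures that `size`
-- is positive.
noDenseMinor : (α : ℕ → ℕ) → KostochkaBound α → ∀ h → 1 ≤ h → ∀ {n} (G : Graph n) →
               ¬ HasMinor (K (suc h)) G → NoDenseMinor G (α h)
noDenseMinor α bound h 1≤h {n} G ¬minor C v Rvv dense =
  contradict size (proj₁ (covers v Rvv))
    (≤-trans (degSum-≥ quotient (suc (α h)) degree)
             (bound h 1≤h size quotient (λ M → ¬minor (lift-minor M))))
  where
  open ConnectedPER C
  open Contraction C
  contradict : ∀ k → Fin k → k * suc (α h) ≤ α h * k → ⊥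
  contradict (suc k) _ le = <-irrefl refl (≤-trans (+-mono-≤ {1} {suc k} (s≤s z≤n) ≤-refl)
    (subst (_≤ α h * suc k) (*-comm (suc k) (suc (α h))) le))
  degree : ∀ i → suc (α h) ≤ deg quotient i
  degree i with dense (rep i) (rep-dom i)
  ... | nb , nb-adj , nb-inj = deg-≥ quotient i class class-inj class-adj
    where
    bnd : (t : Fin (suc (α h))) → toℕ t ≤ α h
    bnd t = ≤-pred (toℕ<n t)
    cover : ∀ t → ∃ λ j → R (nb (toℕ t)) (rep j)
    cover t with nb-adj (toℕ t) (bnd t)
    ... | _ , _ , _ , _ , _ , q = covers _ (domˡ (R-sym q))
    class : Fin (suc (α h)) → Fin size
    class t = proj₁ (cover t)
    class-inj : ∀ {s t} → class s ≡ class t → s ≡ t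
    class-inj {s} {t} eq = toℕ-injective (nb-inj _ _ (bnd s) (bnd t)
      (R-trans (proj₂ (cover s)) (subst (λ j → R (rep j) (nb (toℕ t))) (sym eq)
          (R-sym (proj₂ (cover t))))))
    class-adj : ∀ t → adj quotient i (class t) ≡ true
    class-adj t = let (¬r , x , y , p , e , q) = nb-adj (toℕ t) (bnd t) in
      dec-true (Edge? i (class t))
        ( (λ eq → ¬r (subst (λ j → R (rep j) (nb (toℕ t))) (sym eq) (R-sym (proj₂ (cover t)))))
        , x , y , p , e , R-trans q (proj₂ (cover t)) )

-- Lagrange's theorem for the cycles of a free cyclic action.

iter : ∀ {A : Set} → (A → A) → ℕ → A → A
iter f zero    x = x
iter f (suc k) x = f (iter f k x)

iter-+ : ∀ {A : Set} (f : A → A) i j x → iter f (i + j) x ≡ iter f i (iter f j x)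
iter-+ f zero    j x = refl
iter-+ f (suc i) j x = cong f (iter-+ f i j x)

least : ∀ {P : ℕ → Set} → Decidable P → ∀ k → P k → ∃ λ l → P l × (∀ j → j < l → ¬ P j)
least {P} P? k pk = go k pk (<-wellFounded k)
  where
  go : ∀ k → P k → Acc _<_ k → ∃ λ l → P l × (∀ j → j < l → ¬ P j)
  go k pk (acc rec) with any? (λ (j : Fin k) → P? (toℕ j))
  ... | yes (j , pj) = go (toℕ j) pj (rec (toℕ<n j))
  ... | no none      = k , pk , λ j j<k pj →
    none (fromℕ< j<k , subst P (sym (toℕ-fromℕ< j<k)) pj)

-- The condition `free` says that an iterate with one fixed point is the identity, as for left
-- multiplication in a group. All cycles then have the same length, and it divides `m`.
module FreeCycles {m : ℕ} (σ : Fin m → Fin m) (σ-inj : ∀ {i j} → σ i ≡ σ j → i ≡ j)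
  (free : ∀ k i j → iter σ k i ≡ i → iter σ k j ≡ j) where

  iter-inj : ∀ k {i j} → iter σ k i ≡ iter σ k j → i ≡ j
  iter-inj zero    eq = eq
  iter-inj (suc k) eq = iter-inj k (σ-inj eq)

  recur : ∀ a b i → a ≤ b → iter σ a i ≡ iter σ b i → iter σ (b ∸ a) i ≡ i
  recur a b i a≤b eq = iter-inj a (trans (sym (iter-+ σ a (b ∸ a) i))
    (trans (cong (λ c → iter σ c i) (m+[n∸m]≡n a≤b)) (sym eq)))

  -- Two of the first `m + 1` iterates agree by the pigeonhole principle, and injectivity carries
  -- the coincidence back to `i₀`. Writing the period as `suc k` keeps it positive.
  period : ∀ i₀ → ∃ λ k → iter σ (suc k) i₀ ≡ i₀ × (∀ j → j < k → iter σ (suc j) i₀ ≢ i₀)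
  period i₀ with pigeonhole (n<1+n m) (λ e → iter σ (toℕ e) i₀)
  ... | a , b , a<b , eq with m≤n⇒∃[o]m+o≡n a<b
  ...   | o , a+o≡b = least (λ k → iter σ (suc k) i₀ ≟ i₀) o
    (iter-inj (toℕ a) (trans (sym (iter-+ σ (toℕ a) (suc o) i₀))
      (trans (cong (λ c → iter σ c i₀) (trans (+-suc (toℕ a) o) a+o≡b)) (sym eq))))

  module UniformPeriod (l : ℕ) (closes : ∀ i → iter σ (suc l) i ≡ i)
    (minimal : ∀ d i → d < suc l → iter σ d i ≡ i → d ≡ 0) where

    k : ℕ
    k = suc l

    closes-* : ∀ c i → iter σ (c * k) i ≡ i
    closes-* zero    i = refl
    closes-* (suc c) i = trans (iter-+ σ k (c * k) i) (trans (closes _) (closes-* c i))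

    R : Fin m → Fin m → Set
    R i j = ∃ λ (e : Fin k) → i ≡ iter σ (toℕ e) j

    reduce : ∀ e j → ∃ λ (e′ : Fin k) → iter σ e j ≡ iter σ (toℕ e′) j
    reduce e j = fromℕ< (m%n<n e (suc l)) , trans (cong (λ c → iter σ c j) (m≡m%n+[m/n]*n e (suc l)))
      (trans (iter-+ σ (e % suc l) (e / suc l * k) j)
          (trans (cong (iter σ (e % suc l)) (closes-* (e / suc l) j))
        (cong (λ c → iter σ c j) (sym (toℕ-fromℕ< (m%n<n e (suc l)))))))

    R-sym : Symmetric R
    R-sym {i} {j} (e , refl) with reduce (k ∸ toℕ e) i
    ... | e′ , eq = e′ , trans (sym (trans (sym (iter-+ σ (k ∸ toℕ e) (toℕ e) j))
        (trans (cong (λ c → iter σ c j)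
            (trans (+-comm (k ∸ toℕ e) (toℕ e)) (m+[n∸m]≡n (<⇒≤ (toℕ<n e)))))
          (closes j)))) eq

    R-trans : Transitive R
    R-trans {i} {j} {l} (e , refl) (e′ , refl) with reduce (toℕ e + toℕ e′) l
    ... | e″ , eq = e″ , trans (sym (iter-+ σ (toℕ e) (toℕ e′) l)) eq

    open Transversal (transversal R (λ i j → any? λ e → i ≟ iter σ (toℕ e) j) R-sym) public

    point : Fin size × Fin k → Fin m
    point (i , e) = iter σ (toℕ e) (rep i)

    point-inj : ∀ p q → point p ≡ point q → p ≡ q
    point-inj (i , e) (i′ , e′) eq
      with rep-inj i i′ (R-trans (R-sym (e , refl)) (e′ , eq))
    ... | refl = cong (i ,_) (toℕ-injective (conclude (≤-total (toℕ e) (toℕ e′))))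
      where
      d≡0 : ∀ {a b} → a ≤ b → b ∸ a ≡ 0 → a ≡ b
      d≡0 {a} {b} a≤b eq = trans (sym (+-identityʳ a)) (trans (cong (a +_) (sym eq)) (m+[n∸m]≡n a≤b))
      conclude : toℕ e ≤ toℕ e′ ⊎ toℕ e′ ≤ toℕ e → toℕ e ≡ toℕ e′
      conclude (inj₁ le) = d≡0 le (minimal _ _ (≤-<-trans (m∸n≤m (toℕ e′) (toℕ e)) (toℕ<n e′))
        (recur (toℕ e) (toℕ e′) (rep i) le eq))
      conclude (inj₂ le) = sym (d≡0 le (minimal _ _ (≤-<-trans (m∸n≤m (toℕ e) (toℕ e′)) (toℕ<n e))
        (recur (toℕ e′) (toℕ e) (rep i) le (sym eq))))

    -- Every point is determined by its cycle and its position on that cycle, counted from the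
    -- representative.
    size*k≡m : size * k ≡ m
    size*k≡m = ↔⇒≡ (permutation to from to-from from-to)
      where
      to : Fin (size * k) → Fin m
      to x = point (remQuot k x)
      cover : ∀ v → ∃ λ i → R v (rep i)
      cover v = covers v (zero , refl)
      from : Fin m → Fin (size * k)
      from v = combine (proj₁ (cover v)) (proj₁ (proj₂ (cover v)))
      to-from : ∀ v → to (from v) ≡ v
      to-from v = trans (cong point (remQuot-combine (proj₁ (cover v)) _))
          (sym (proj₂ (proj₂ (cover v))))
      from-to : ∀ x → from (to x) ≡ x
      from-to x = trans (sym (combine-remQuot {size} k (from (to x))))
        (trans (cong (λ p → combine (proj₁ p) (proj₂ p)) (point-inj _ _ (to-from (to x))))
          (combine-remQuot {size} k x))

  lagrange : ∀ i → iter σ m i ≡ i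
  lagrange i with period i
  ... | l , closes , minimal = subst (λ c → iter σ c i ≡ i) size*k≡m (closes-* size i)
    where
    minimal′ : ∀ d j → d < suc l → iter σ d j ≡ j → d ≡ 0
    minimal′ zero    j d<k       eq = refl
    minimal′ (suc d) j (s≤s d<k) eq = ⊥-elim (minimal d d<k (free (suc d) j i eq))
    open UniformPeriod l (λ j → free (suc l) i j closes) minimal′

-- The automorphism group as a finite set.

module Enumeration {n : ℕ} (G : Graph n) where

  open Group (Aut G) public using (_≈_; _∙_; ε; _⁻¹)

  infixr 6 _·_
  _·_ : Auto G → Fin n → Fin n
  g · v = perm g ⟨$⟩ʳ v

  ·-adj : ∀ g {u v} → adj G u v ≡ true → adj G (g · u) (g · v) ≡ true
  ·-adj g {u} {v} e = trans (preserve g u v) e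

  private
    code : (Fin n → Fin n) → Fin (n ^ n)
    code = funToFin
    decode : Fin (n ^ n) → Fin n → Fin n
    decode = finToFun

    funToFin-cong : ∀ {k l} {f g : Fin k → Fin l} → (∀ i → f i ≡ g i) → funToFin f ≡ funToFin g
    funToFin-cong {zero}  e = refl
    funToFin-cong {suc k} e = cong₂ combine (e zero) (funToFin-cong (e ∘ suc))

    IsAuto : Fin (n ^ n) → Set
    IsAuto c = (∃ λ d → (∀ v → decode c (decode d v) ≡ v) × (∀ v → decode d (decode c v) ≡ v))
             × (∀ u v → adj G (decode c u) (decode c v) ≡ adj G u v)

    IsAuto? : Decidable IsAuto
    IsAuto? c = any? (λ d → all? (λ v → decode c (decode d v) ≟ v) ×-dec all?
        (λ v → decode d (decode c v) ≟ v))
      ×-dec all? λ u → all? λ v → adj G (decode c u) (decode c v) Bool.≟ adj G u v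

    -- Equality restricted to the codes of automorphisms, so that a transversal of this relation
    -- lists every automorphism exactly once.
    Same : Fin (n ^ n) → Fin (n ^ n) → Set
    Same c d = c ≡ d × IsAuto c

    Same-sym : Symmetric Same
    Same-sym (refl , a) = refl , a

    module T = Transversal (transversal Same (λ c d → (c ≟ d) ×-dec IsAuto? c) Same-sym)

    toAuto : ∀ c → IsAuto c → Auto G
    toAuto c ((d , cd , dc) , p) = record
        { perm = permutation (decode c) (decode d) cd dc ; preserve = p }

    code-isAuto : ∀ g → IsAuto (code (g ·_))
    code-isAuto g = (code ((g ⁻¹) ·_)
      , (λ v → trans (dec g _) (trans (cong (g ·_) (dec (g ⁻¹) v)) (inverseʳ (perm g))))
      , (λ v → trans (dec (g ⁻¹) _) (trans (cong ((g ⁻¹) ·_) (dec g v)) (inverseˡ (perm g)))))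
      , λ u v → trans (cong₂ (adj G) (dec g u) (dec g v)) (preserve g u v)
      where
      dec : ∀ g v → decode (code (g ·_)) v ≡ g · v
      dec g = finToFun-funToFin (g ·_)

  opaque
    order : ℕ
    order = T.size

    element : Fin order → Auto G
    element i = toAuto (T.rep i) (proj₂ (T.rep-dom i))

    index : Auto G → Fin order
    index g = proj₁ (T.covers (code (g ·_)) (refl , code-isAuto g))

    element-index : ∀ g → element (index g) ≈ g
    element-index g v = trans
      (cong (λ c → decode c v) (sym (proj₁ (proj₂ (T.covers (code (g ·_)) (refl , code-isAuto g))))))
      (finToFun-funToFin (g ·_) v)

    element-injective : ∀ {i j} → element i ≈ element j → i ≡ j
    element-injective {i} {j} e = T.rep-inj i j
      (trans (sym (funToFin-finToFin {n} {n} (T.rep i)))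
          (trans (funToFin-cong {n} {n} e) (funToFin-finToFin {n} {n} (T.rep j)))
      , proj₂ (T.rep-dom i))

  index-cong : ∀ {g h} → g ≈ h → index g ≡ index h
  index-cong {g} {h} e = element-injective λ v →
    trans (element-index g v) (trans (e v) (sym (element-index h v)))

  enumeration : Inverse (setoid (Fin order)) (Group.setoid (Aut G))
  enumeration = record
    { to = element ; from = index
    ; to-cong = λ { refl v → refl }
    ; from-cong = λ {g} {h} → index-cong {g} {h}
    ; inverse = (λ { {g} refl → element-index g })
              , (λ { {i} {g} e → trans (index-cong {g} {element i} e)
                                       (element-injective (element-index (element i))) }) }

  search : {P : Auto G → Set} → (∀ {g h} → g ≈ h → P g → P h) → Decidable P → Dec (∃ P)
  search {P} resp P? = map′ (λ { (i , p) → element i , p })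
    (λ { (g , p) → index g , resp {g} {element (index g)} (λ v → sym (element-index g v)) p })
    (any? λ i → P? (element i))

  check : {P : Auto G → Set} → (∀ {g h} → g ≈ h → P g → P h) → Decidable P → Dec (∀ g → P g)
  check {P} resp P? = map′ (λ p g → resp {element (index g)} {g} (element-index g) (p (index g)))
    (λ p i → p (element i)) (all? λ i → P? (element i))

  pow : Auto G → ℕ → Auto G
  pow g zero    = ε
  pow g (suc k) = g ∙ pow g k

  -- Lagrange's theorem for the cyclic subgroup generated by g, which acts freely
  -- on the whole group by left multiplication.
  pow-order : ∀ g v → pow g order · v ≡ v
  pow-order g v = begin
    pow g order · v                            ≡⟨ cong (pow g order ·_) (element-index ε v) ⟨
    pow g order · element (index ε) · v        ≡⟨ σ-pow order (index ε) v ⟨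
    element (iter σ order (index ε)) · v       ≡⟨ cong (λ i → element i · v) (F.lagrange (index ε)) ⟩
    element (index ε) · v                      ≡⟨ element-index ε v ⟩
    v                                          ∎
    where
    open ≡-Reasoning
    σ : Fin order → Fin order
    σ i = index (g ∙ element i)
    σ-pow : ∀ k i v → element (iter σ k i) · v ≡ pow g k · element i · v
    σ-pow zero    i v = refl
    σ-pow (suc k) i v = trans (element-index (g ∙ element (iter σ k i)) v) (cong (g ·_) (σ-pow k i v))
    σ-inj : ∀ {i j} → σ i ≡ σ j → i ≡ j
    σ-inj {i} {j} eq = element-injective λ v → ·-injective
        (trans (sym (element-index (g ∙ element i) v))
      (trans (cong (λ l → element l · v) eq) (element-index (g ∙ element j) v)))
      where
      ·-injective : ∀ {u v} → g · u ≡ g · v → u ≡ v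
      ·-injective e = trans (sym (inverseˡ (perm g)))
          (trans (cong (perm g ⟨$⟩ˡ_) e) (inverseˡ (perm g)))
    free : ∀ k i j → iter σ k i ≡ i → iter σ k j ≡ j
    free k i j eq = element-injective λ v → trans (σ-pow k j v) (fixed (element j · v))
      where
      fixed : ∀ w → pow g k · w ≡ w
      fixed w = trans (cong (pow g k ·_) (sym (inverseʳ (perm (element i)))))
        (trans (sym (σ-pow k i _)) (trans (cong (λ l → element l · _) eq)
            (inverseʳ (perm (element i)))))
    module F = FreeCycles σ σ-inj free

-- Subgroups and their action on vertices.

module GroupAction {n : ℕ} (G : Graph n) where

  open Enumeration G public

  cancelˡ : ∀ g v → g ⁻¹ · g · v ≡ v
  cancelˡ g v = inverseˡ (perm g)

  cancelʳ : ∀ g v → g · g ⁻¹ · v ≡ v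
  cancelʳ g v = inverseʳ (perm g)

  ·-injective : ∀ g {u v} → g · u ≡ g · v → u ≡ v
  ·-injective g eq = trans (sym (cancelˡ g _)) (trans (cong (g ⁻¹ ·_) eq) (cancelˡ g _))

  transpose : ∀ g {u v} → g · u ≡ v → g ⁻¹ · v ≡ u
  transpose g refl = cancelˡ g _

  ⁻¹-cong : ∀ g h → g ≈ h → g ⁻¹ ≈ h ⁻¹
  ⁻¹-cong g h = Group.⁻¹-cong (Aut G) {g} {h}

  record Subgroup : Set₁ where
    field
      mem    : Auto G → Set
      mem?   : Decidable mem
      resp   : ∀ {g h} → g ≈ h → mem g → mem h
      ε-mem  : mem ε
      ∙-mem  : ∀ {g h} → mem g → mem h → mem (g ∙ h)
      ⁻¹-mem : ∀ {g} → mem g → mem (g ⁻¹)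

    pow-mem : ∀ {g} → mem g → ∀ k → mem (pow g k)
    pow-mem p zero    = ε-mem
    pow-mem p (suc k) = ∙-mem p (pow-mem p k)

  Invariant : Subgroup → (Fin n → Set) → Set
  Invariant H S = ∀ {h v} → Subgroup.mem H h → S v → S (h · v)

  Invariant₂ : Subgroup → (Fin n → Fin n → Set) → Set
  Invariant₂ H R = ∀ {h u v} → Subgroup.mem H h → R u v → R (h · u) (h · v)

  Connected : (Fin n → Set) → Set
  Connected S = ∀ {u v} → S u → S v → Reach G S u v

  reach-· : ∀ g {P Q : Fin n → Set} → (∀ {w} → P w → Q (g · w)) →
            ∀ {u v} → Reach G P u v → Reach G Q (g · u) (g · v)
  reach-· g f here         = here
  reach-· g f (step e p r) = step (·-adj g e) (f p) (reach-· g f r)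

  module _ (H : Subgroup) where
    open Subgroup H

    search-mem : {P : Auto G → Set} → (∀ {g h} → g ≈ h → P g → P h) → Decidable P →
                 Dec (∃ λ g → mem g × P g)
    search-mem r P? = search (λ e (m , p) → resp e m , r e p) (λ g → mem? g ×-dec P? g)

    inv₂ : ∀ (R : Fin n → Fin n → Set) → Invariant₂ H R → ∀ {h u v} → mem h → R (h · u) (h · v) → R u v
    inv₂ R inv {h} {u} {v} m r = subst (λ x → R x v) (cancelˡ h u)
      (subst (λ x → R (h ⁻¹ · h · u) x) (cancelˡ h v) (inv (⁻¹-mem m) r))

record Setting {n : ℕ} (G : Graph n) : Set₁ where
  field
    α       : ℕ
    sparse  : NoDenseMinor G α
    coprime : ∀ d → 1 ≤ d → d ≤ α → Coprime d (Enumeration.order G)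
    odd     : Coprime 2 (Enumeration.order G)

-- Large orbits against sparseness.

module Sparse {n : ℕ} {G : Graph n} (setting : Setting G) where

  open Setting setting public
  open GroupAction G public

  -- The group order is a period of the powers of `h` on `y` and is coprime to every positive number
  -- up to `α`. This is a main source of vertices with more than `α` neighbours.
  pow-distinct : ∀ H (R : Fin n → Fin n → Set) → Symmetric R → Transitive R → Invariant₂ H R →
    ∀ {h y} → Subgroup.mem H h → R y y → ¬ R (h · y) y →
    ∀ i j → i ≤ α → j ≤ α → R (pow h i · y) (pow h j · y) → i ≡ j
  pow-distinct H R R-sym R-trans R-inv {h} {y} m ryy move i j i≤α j≤α =
    distinct-orbit R R-sym R-trans (λ k → pow h k · y)
      (λ _ _ → R-inv m) (λ _ _ → inv₂ H R R-inv m) order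
      (subst (λ v → R v y) (sym (pow-order h y)) ryy) move α coprime
      i j i≤α j≤α

  -- Otherwise the powers of h would give the class of x, and hence every class,
  -- more than α neighbours.
  stable-neighbour : ∀ H (C : ConnectedPER G) → let open ConnectedPER C in Invariant₂ H R →
    (∀ {v w} → R v v → R w w → ∃ λ h → Subgroup.mem H h × R (h · v) w) →
    ∀ {x y h} → adj G x y ≡ true → R x x → R y y → Subgroup.mem H h → R (h · x) x → R (h · y) y
  stable-neighbour H C R-inv R-transitive {x} {y} {h} exy rx ry m hx = conclude (R? x y) (R? (h · y) y)
    where
    open ConnectedPER C
    open Subgroup H
    pow-x : ∀ i → R x (pow h i · x)
    pow-x zero    = rx
    pow-x (suc i) = R-trans (R-sym hx) (R-inv m (pow-x i))
    conclude : Dec (R x y) → Dec (R (h · y) y) → R (h · y) y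
    conclude _         (yes p) = p
    conclude (yes xy)  _       = R-trans (R-inv m (R-sym xy)) (R-trans hx xy)
    conclude (no ¬xy) (no ¬hy) = ⊥-elim (sparse C x rx dense)
      where
      dense : ∀ u → R u u → ∃ λ (nb : ℕ → Fin n) → (∀ i → i ≤ α → Adjacent u (nb i)) ×
              (∀ i j → i ≤ α → j ≤ α → R (nb i) (nb j) → i ≡ j)
      dense u ru with R-transitive rx ru
      ... | k , mk , kxu = (λ i → k · pow h i · y)
        , (λ i _ →
            (λ r → ¬xy (inv₂ H R R-inv (pow-mem m i)
              (R-trans (R-sym (pow-x i)) (inv₂ H R R-inv mk (R-trans kxu r)))))
          , k · pow h i · x , k · pow h i · y
          , R-trans (R-sym kxu) (R-inv mk (pow-x i)) , ·-adj k (·-adj (pow h i) exy)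
          , R-inv mk (R-inv (pow-mem m i) ry))
        , λ i j i≤α j≤α r → pow-distinct H R R-sym R-trans R-inv m ry ¬hy i j i≤α j≤α
            (inv₂ H R R-inv mk r)

  -- Spreads `stable-neighbour` along a walk: once `h` stabilises one class, it stabilises every
  -- class that a walk inside the domain reaches.
  stable-class : ∀ H (C : ConnectedPER G) → let open ConnectedPER C in Invariant₂ H R →
    (∀ {v w} → R v v → R w w → ∃ λ h → Subgroup.mem H h × R (h · v) w) →
    ∀ {S : Fin n → Set} → (∀ {v} → S v → R v v) →
    ∀ {h} → Subgroup.mem H h → ∀ {u v} → R (h · u) u → Reach G S u v → R (h · v) v
  stable-class H C R-inv R-transitive dom {h} m = reach-closed {Q = λ v → R (h · v) v}
    λ r e s → stable-neighbour H C R-inv R-transitive e (domˡ (R-sym r)) (dom s) m r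
    where open ConnectedPER C

  -- Equivariant retractions onto an orbit.

  -- e contracts S to a minor on which H acts; a retraction contracts this minor
  -- further, onto the orbit of b.
  record Precontraction (H : Subgroup) (S : Fin n → Set) (b : Fin n) : Set where
    open Subgroup H
    field
      e       : Fin n → Fin n
      e-in    : ∀ {v} → S v → S (e v)
      e-equi  : ∀ {h v} → mem h → S v → e (h · v) ≡ h · e v
      e-idem  : ∀ {v} → S v → e (e v) ≡ e v
      e-conn  : ∀ {v} → S v → Reach G (λ w → S w × e w ≡ e v) v (e v)
      e-b     : e b ≡ b

  trivialPrecontraction : ∀ H S b → Precontraction H S b
  trivialPrecontraction H S b = record
    { e = λ v → v ; e-in = λ s → s ; e-equi = λ _ _ → refl ; e-idem = λ _ → refl
    ; e-conn = λ _ → here ; e-b = refl }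

  module Growth (H : Subgroup) (S : Fin n → Set) (S? : Decidable S) (S-inv : Invariant H S)
    (S-conn : Connected S) (b : Fin n) (b∈S : S b) (pre : Precontraction H S b) where

    open Subgroup H
    open Precontraction pre

    -- `W` is the part of `S` treated so far. By `W-e` and `W-e⁻` it is a union of fibres of `e`,
    -- and `f` retracts it onto the orbit of `b` with connected fibres.
    record Retraction (W : Fin n → Set) : Set where
      field
        W?     : Decidable W
        W⊆S    : ∀ {v} → W v → S v
        W-inv  : Invariant H W
        W-e    : ∀ {v} → W v → W (e v)
        W-e⁻   : ∀ {v} → S v → W (e v) → W v
        b∈W    : W b
        f      : Fin n → Fin n
        f-b    : f b ≡ b
        f-orb  : ∀ {v} → W v → ∃ λ h → mem h × f v ≡ h · b
        f-equi : ∀ {h v} → mem h → W v → f (h · v) ≡ h · f v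
        f-e    : ∀ {v} → W v → f (e v) ≡ f v
        f-conn : ∀ {v} → W v → Reach G (λ w → W w × f w ≡ f v) v (f v)

      f-orbit-b : ∀ {h} → mem h → f (h · b) ≡ h · b
      f-orbit-b {h} m = trans (f-equi m b∈W) (cong (h ·_) f-b)

      f-in : ∀ {v} → W v → W (f v)
      f-in wv with f-orb wv
      ... | h , m , eq = subst W (sym eq) (W-inv m b∈W)

      f-idem : ∀ {v} → W v → f (f v) ≡ f v
      f-idem wv with f-orb wv
      ... | h , m , eq = subst (λ u → f u ≡ u) (sym eq) (f-orbit-b m)

      fibre : ConnectedPER G
      fibre = record
        { R = λ u v → W u × W v × f u ≡ f v
        ; R? = λ u v → W? u ×-dec (W? v ×-dec (f u ≟ f v))
        ; R-sym = λ { (p , q , eq) → q , p , sym eq }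
        ; R-trans = λ { (p , _ , eq) (_ , q , eq′) → p , q , trans eq eq′ }
        ; R-conn = λ { {u} (p , q , eq) → reach-trans
            (reach-map (λ { (w , eq′) → p , w , sym eq′ }) (f-conn p))
            (subst (λ z → Reach G (λ w → W u × W w × f u ≡ f w) z _) (sym eq) (reach-sym (p , q , eq)
              (reach-map (λ { (w , eq′) → p , w , trans eq (sym eq′) }) (f-conn q)))) } }

    -- This makes the assignment of `h · f x` to `h · e v` independent of the choice of `h`, so that
    -- the orbit of `v` can be added to `W` along the edge to `x`.
    Attachable : Set₁
    Attachable = ∀ {W} (ρ : Retraction W) → let open Retraction ρ in ∀ {v x} → S v → ¬ W v → W x → adj G x v ≡ true →
                 ∀ {h} → mem h → h · e v ≡ e v → h · f x ≡ f x

    initial : ∃ λ (W : Fin n → Set) → Retraction W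
    initial = (λ v → S v × ∃ λ h → mem h × e v ≡ h · b) , record
      { W? = λ v → S? v ×-dec search-mem H (λ g≈h eq → trans eq (g≈h b)) (λ h → e v ≟ h · b)
      ; W⊆S = proj₁
      ; W-inv = λ { {g} mg (s , h , mh , eq) →
          S-inv mg s , g ∙ h , ∙-mem mg mh , trans (e-equi mg s) (cong (g ·_) eq) }
      ; W-e = λ { (s , h , mh , eq) → e-in s , h , mh , trans (e-idem s) eq }
      ; W-e⁻ = λ { s (_ , h , mh , eq) → s , h , mh , trans (sym (e-idem s)) eq }
      ; b∈W = b∈S , ε , ε-mem , e-b
      ; f = e
      ; f-b = e-b
      ; f-orb = proj₂
      ; f-equi = λ mh (s , _) → e-equi mh s
      ; f-e = λ (s , _) → e-idem s
      ; f-conn = λ (s , h , mh , eq) →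
          reach-map (λ { (sw , eq′) → (sw , h , mh , trans eq′ eq) , eq′ }) (e-conn s) }

    module Extend (attachable : Attachable) {W : Fin n → Set} (ρ : Retraction W) {v x : Fin n}
      (v∈S : S v) (v∉W : ¬ W v) (x∈W : W x) (exv : adj G x v ≡ true) where
      open Retraction ρ

      -- The union of the translates under `H` of the fibre of `e` through `v`; it is added to `W`
      -- in one step.
      N : Fin n → Set
      N u = S u × ∃ λ h → mem h × e u ≡ h · e v

      N? : Decidable N
      N? u = S? u ×-dec search-mem H (λ g≈h eq → trans eq (g≈h (e v))) (λ h → e u ≟ h · e v)

      f⁺ : Fin n → Fin n
      f⁺ u with W? u | N? u
      ... | yes _ | _                     = f u
      ... | no _  | yes (_ , h , _ , _) = h · f x
      ... | no _  | no _                  = u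

      f⁺-W : ∀ {u} → W u → f⁺ u ≡ f u
      f⁺-W {u} w with W? u | N? u
      ... | yes _ | _ = refl
      ... | no ¬w | _ = ⊥-elim (¬w w)

      N∩W : ∀ {u} → N u → ¬ W u
      N∩W (s , h , mh , eq) w = v∉W (W-e⁻ v∈S
          (subst W (transpose h (sym eq)) (W-inv (⁻¹-mem mh) (W-e w))))

      -- Two elements carrying `e v` to `e u` differ by an element of the stabiliser of `e v`, which
      -- fixes `f x` by `attachable`.
      f⁺-N : ∀ {u h} → S u → mem h → e u ≡ h · e v → f⁺ u ≡ h · f x
      f⁺-N {u} {h} s mh eq with W? u | N? u
      ... | yes w | _     = ⊥-elim (N∩W (s , h , mh , eq) w)
      ... | no _  | no ¬n = ⊥-elim (¬n (s , h , mh , eq))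
      ... | no _  | yes (_ , h′ , mh′ , eq′) = sym (trans (cong (h ·_) (sym fixed)) (cancelʳ h _))
        where
        fixed : (h ⁻¹ ∙ h′) · f x ≡ f x
        fixed = attachable ρ v∈S v∉W x∈W exv (∙-mem (⁻¹-mem mh) mh′)
          (trans (cong (h ⁻¹ ·_) (trans (sym eq′) eq)) (cancelˡ h _))

      W⁺ : Fin n → Set
      W⁺ u = W u ⊎ N u

      extended : Retraction W⁺
      extended = record
        { W? = λ u → W? u ⊎-dec N? u
        ; W⊆S = λ { (inj₁ w) → W⊆S w ; (inj₂ (s , _)) → s }
        ; W-inv = λ { mg (inj₁ w) → inj₁ (W-inv mg w)
                    ; {g} mg (inj₂ (s , h , mh , eq)) → inj₂
                        (S-inv mg s , g ∙ h , ∙-mem mg mh , trans (e-equi mg s) (cong (g ·_) eq)) }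
        ; W-e = λ { (inj₁ w) → inj₁ (W-e w)
                  ; (inj₂ (s , h , mh , eq)) → inj₂ (e-in s , h , mh , trans (e-idem s) eq) }
        ; W-e⁻ = λ { s (inj₁ w) → inj₁ (W-e⁻ s w)
                   ; s (inj₂ (_ , h , mh , eq)) → inj₂ (s , h , mh , trans (sym (e-idem s)) eq) }
        ; b∈W = inj₁ b∈W
        ; f = f⁺
        ; f-b = trans (f⁺-W b∈W) f-b
        ; f-orb = λ { (inj₁ w) → let (h , mh , eq) = f-orb w in h , mh , trans (f⁺-W w) eq
                    ; (inj₂ (s , h , mh , eq)) → let (g , mg , eq′) = f-orb x∈W in
                        h ∙ g , ∙-mem mh mg , trans (f⁺-N s mh eq) (cong (h ·_) eq′) }
        ; f-equi = λ { {g} mg (inj₁ w) → trans (f⁺-W (W-inv mg w))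
                         (trans (f-equi mg w) (cong (g ·_) (sym (f⁺-W w))))
                     ; {g} mg (inj₂ (s , h , mh , eq)) → trans
                         (f⁺-N {h = g ∙ h} (S-inv mg s) (∙-mem mg mh)
                             (trans (e-equi mg s) (cong (g ·_) eq)))
                         (cong (g ·_) (sym (f⁺-N s mh eq))) }
        ; f-e = λ { (inj₁ w) → trans (f⁺-W (W-e w)) (trans (f-e w) (sym (f⁺-W w)))
                  ; (inj₂ (s , h , mh , eq)) → trans (f⁺-N (e-in s) mh (trans (e-idem s) eq))
                      (sym (f⁺-N s mh eq)) }
        ; f-conn = λ { (inj₁ w) → W-path w ; (inj₂ nu) → N-path nu } }
        where
        W-path : ∀ {u} → W u → Reach G (λ w → W⁺ w × f⁺ w ≡ f⁺ u) u (f⁺ u)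
        W-path {u} wu = subst (Reach G _ u) (sym (f⁺-W wu))
          (reach-map (λ (w , eq) → inj₁ w , trans (f⁺-W w) (trans eq (sym (f⁺-W wu)))) (f-conn wu))
        N-path : ∀ {u} → N u → Reach G (λ w → W⁺ w × f⁺ w ≡ f⁺ u) u (f⁺ u)
        -- The walk goes from `u` to `e u`, which is `h · e v`, then inside the same fibre of `e` to
        -- `h · v`, across the translated edge to `h · x`, and on inside `W`.
        N-path {u} (s , h , mh , eq) = reach-trans to-e (reach-trans to-hv
          (step (adj-sym {G = G} (·-adj h exv)) (inj₁ hx∈W , sym same)
            (subst (λ z → Reach G (λ w → W⁺ w × f⁺ w ≡ z) (h · x) z) (sym same) (W-path hx∈W))))
          where
          hx∈W : W (h · x)
          hx∈W = W-inv mh x∈W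
          fu : f⁺ u ≡ h · f x
          fu = f⁺-N s mh eq
          same : f⁺ u ≡ f⁺ (h · x)
          same = trans fu (sym (trans (f⁺-W hx∈W) (f-equi mh x∈W)))
          ehv : e (h · v) ≡ h · e v
          ehv = e-equi mh v∈S
          in-fibre : ∀ {w} → S w → e w ≡ h · e v → W⁺ w × f⁺ w ≡ f⁺ u
          in-fibre sw ew = inj₂ (sw , h , mh , ew) , trans (f⁺-N sw mh ew) (sym fu)
          to-e : Reach G (λ w → W⁺ w × f⁺ w ≡ f⁺ u) u (h · e v)
          to-e = subst (Reach G _ u) eq
            (reach-map (λ (sw , eq′) → in-fibre sw (trans eq′ eq)) (e-conn s))
          to-hv : Reach G (λ w → W⁺ w × f⁺ w ≡ f⁺ u) (h · e v) (h · v)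
          to-hv = reach-sym (in-fibre (S-inv mh v∈S) ehv)
            (subst (Reach G _ (h · v)) ehv
              (reach-map (λ (sw , eq′) → in-fibre sw (trans eq′ ehv)) (e-conn (S-inv mh v∈S))))

    -- As `S` is connected, an edge leaves `W` as long as `W` is not all of `S`; each extension
    -- lowers the number of vertices outside `W`.
    retraction : Attachable → Retraction S
    retraction attachable = let (_ , ρ) = initial in go ρ (<-wellFounded _)
      where
      finish : ∀ {W} → Retraction W → (∀ {v} → S v → W v) → Retraction S
      finish ρ S⊆W = record
        { W? = S? ; W⊆S = λ s → s ; W-inv = S-inv ; W-e = e-in ; W-e⁻ = λ s _ → s ; b∈W = b∈S ;
            f = f ; f-b = f-b
        ; f-orb = λ s → f-orb (S⊆W s) ; f-equi = λ mh s → f-equi mh (S⊆W s) ; f-e = λ s → f-e (S⊆W s)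
        ; f-conn = λ s → reach-map (λ (w , eq) → W⊆S w , eq) (f-conn (S⊆W s)) }
        where open Retraction ρ
      go : ∀ {W} (ρ : Retraction W) → Acc _<_ (count (λ v → ¬? (Retraction.W? ρ v))) → Retraction S
      go {W} ρ (acc rec) with any? (λ v → any? λ x → S? v ×-dec (¬? (Retraction.W? ρ v) ×-dec
                                   (Retraction.W? ρ x ×-dec (adj G x v Bool.≟ true))))
      ... | no none = finish ρ λ {v} s → reach-closed
        (λ {u} {w} wu e sw → decidable-stable (W? w) λ ¬w → none (w , u , sw , ¬w , wu , e))
        b∈W (S-conn b∈S s)
        where open Retraction ρ
      ... | yes (v , x , v∈S , v∉W , x∈W , exv) = go E.extended
        (rec (count-< (λ u → ¬? (Retraction.W? E.extended u)) (λ u → ¬? (Retraction.W? ρ u))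
          (λ ¬w⁺ w → ¬w⁺ (inj₁ w)) v (λ ¬w⁺ → ¬w⁺ (inj₂ (v∈S , ε , Subgroup.ε-mem H , refl))) v∉W))
        where module E = Extend attachable ρ v∈S v∉W x∈W exv

-- Retractions onto the orbit of a vertex with maximal stabiliser.

module Retractions {n : ℕ} {G : Graph n} (setting : Setting G) where

  open Sparse setting public

  pow-fixed : ∀ {g v} → g · v ≡ v → ∀ i → pow g i · v ≡ v
  pow-fixed     eq zero    = refl
  pow-fixed {g} eq (suc i) = trans (cong (g ·_) (pow-fixed {g} eq i)) eq

  -- Serves the minors with two kinds of branch sets: contracted classes on one side, and the single
  -- vertices of an orbit on the other.
  withSingletons : ConnectedPER G → {O : Fin n → Set} → Decidable O → ConnectedPER G
  withSingletons C {O} O? = record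
    { R = λ u v → R u v ⊎ (u ≡ v × O u × ¬ R u u)
    ; R? = λ u v → R? u v ⊎-dec ((u ≟ v) ×-dec (O? u ×-dec ¬? (R? u u)))
    ; R-sym = λ { (inj₁ r) → inj₁ (R-sym r) ; (inj₂ (refl , o)) → inj₂ (refl , o) }
    ; R-trans = λ { (inj₁ r) (inj₁ s) → inj₁ (R-trans r s) ; (inj₂ (refl , o)) s → s
                  ; r@(inj₁ _) (inj₂ (refl , o)) → r }
    ; R-conn = λ { (inj₁ r) → reach-map inj₁ (R-conn r) ; (inj₂ (refl , o)) → here } }
    where open ConnectedPER C

  OrbitRetraction : ∀ H (S : Fin n → Set) (S? : Decidable S) → Invariant H S → Connected S → ∀ b →
      S b → Set
  OrbitRetraction H S S? S-inv S-conn b b∈S =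
    Growth.Retraction H S S? S-inv S-conn b b∈S (trivialPrecontraction H S b) S

  -- The preorder given by inclusion of stabilisers; `b` is chosen maximal for it.
  Fixes : Subgroup → Fin n → Fin n → Set
  Fixes H u v = ∀ h → Subgroup.mem H h → h · u ≡ u → h · v ≡ v

  Fixes? : ∀ H → Decidable₂ (Fixes H)
  Fixes? H u v = check
    (λ {g} {h} g≈h p m eq → trans (sym (g≈h v)) (p (resp (λ w → sym (g≈h w)) m) (trans (g≈h u) eq)))
    (λ h → mem? h →-dec ((h · u ≟ u) →-dec (h · v ≟ v)))
    where open Subgroup H

  MaximalStabiliser : Subgroup → (Fin n → Set) → Fin n → Set
  MaximalStabiliser H S b = ∀ v → S v → Fixes H b v → Fixes H v b

  maximalStabiliser : ∀ H {S : Fin n → Set} → Decidable S → ∀ v → S v →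
                      ∃ λ b → S b × MaximalStabiliser H S b
  maximalStabiliser H S? v s =
    maximal S? (Fixes H) (Fixes? H) (λ _ _ eq → eq) (λ p q h m eq → q h m (p h m eq)) v s

  module Maximal (H : Subgroup) (S : Fin n → Set) (S? : Decidable S) (S-inv : Invariant H S)
    (S-conn : Connected S) (b : Fin n) (b∈S : S b) (b-max : MaximalStabiliser H S b) where

    open Subgroup H
    open Growth H S S? S-inv S-conn b b∈S (trivialPrecontraction H S b) public

    module _ {W : Fin n → Set} (ρ : Retraction W) {v x : Fin n}
      (v∈S : S v) (v∉W : ¬ W v) (x∈W : W x) (exv : adj G x v ≡ true) where

      open Retraction ρ

      -- As `f x` is a translate `g · b`, conjugation by `g` carries the maximality of the
      -- stabiliser of `b` over to that of `f x`.
      Fixes-b⇒ : Fixes H (f x) v → Fixes H v (f x)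
      Fixes-b⇒ p h m hv with f-orb x∈W
      ... | g , mg , eq = trans (cong (h ·_) eq) (trans (trans (sym (cancelʳ g _)) (cong (g ·_)
        (b-max (g ⁻¹ · v) (S-inv (⁻¹-mem mg) v∈S) below ((g ⁻¹ ∙ h) ∙ g)
            (∙-mem (∙-mem (⁻¹-mem mg) m) mg)
          (cong (g ⁻¹ ·_) (trans (cong (h ·_) (cancelʳ g v)) hv))))) (sym eq))
        where
        below : Fixes H b (g ⁻¹ · v)
        below k mk kb = trans (sym (cancelˡ g _)) (cong (g ⁻¹ ·_)
          (p ((g ∙ k) ∙ g ⁻¹) (∙-mem (∙-mem mg mk) (⁻¹-mem mg))
            (trans (cong (λ w → g · k · g ⁻¹ · w) eq)
              (trans (cong (λ w → g · k · w) (cancelˡ g b)) (trans (cong (g ·_) kb) (sym eq))))))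

      -- k and h move the two ends of the edge in the contracted graph in turn, so both
      -- ends would have more than α neighbours.
      incomparable : ∀ {h k} → mem h → h · v ≡ v → h · f x ≢ f x → mem k → k · f x ≡ f x → k · v ≢ v → ⊥
      incomparable {h} {k} mh hv hfx mk kfx kv =
        sparse C x (inj₁ (x∈W , x∈W , refl)) dense
        where
        O : Fin n → Set
        O u = ∃ λ g → mem g × u ≡ g · v
        O? : Decidable O
        O? u = search-mem H (λ g≈h eq → trans eq (g≈h v)) (λ g → u ≟ g · v)
        C : ConnectedPER G
        C = withSingletons fibre O?
        open ConnectedPER C using (R; Adjacent)
        O∩W : ∀ {u} → O u → ¬ W u
        O∩W (g , mg , refl) w = v∉W (subst W (cancelˡ g v) (W-inv (⁻¹-mem mg) w))
        single : ∀ {u} → O u → R u u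
        single o = inj₂ (refl , o , λ (w , _) → O∩W o w)
        dense : ∀ u → R u u → ∃ λ (nb : ℕ → Fin n) → (∀ i → i ≤ α → Adjacent u (nb i)) ×
                (∀ i j → i ≤ α → j ≤ α → R (nb i) (nb j) → i ≡ j)
        dense u (inj₁ (wu , _)) with f-orb wu | f-orb x∈W
        ... | g , mg , fu | g₀ , mg₀ , fx = nb
          , (λ i _ → apart i , p · pow k i · x , nb i
            , inj₁ (wu , W-inv mp (W-inv (pow-mem mk i) x∈W) , same i)
            , ·-adj p (·-adj (pow k i) exv) , single (nb∈O i))
          , distinct
          where
          p : Auto G
          p = g ∙ g₀ ⁻¹
          mp : mem p
          mp = ∙-mem mg (⁻¹-mem mg₀)
          nb : ℕ → Fin n
          nb i = p · pow k i · v
          nb∈O : ∀ i → O (nb i)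
          nb∈O i = p ∙ pow k i , ∙-mem mp (pow-mem mk i) , refl
          apart : ∀ i → ¬ R u (nb i)
          apart i (inj₁ (_ , w , _)) = O∩W (nb∈O i) w
          apart i (inj₂ (eq , _))    = O∩W (subst O (sym eq) (nb∈O i)) wu
          same : ∀ i → f u ≡ f (p · pow k i · x)
          same i = trans fu (sym (trans (f-equi mp (W-inv (pow-mem mk i) x∈W)) (trans (cong (p ·_)
            (trans (f-equi (pow-mem mk i) x∈W) (trans (pow-fixed {g = k} kfx i) fx)))
            (cong (g ·_) (cancelˡ g₀ b)))))
          distinct : ∀ i j → i ≤ α → j ≤ α → R (nb i) (nb j) → i ≡ j
          distinct i j i≤α j≤α (inj₁ (w , _)) = ⊥-elim (O∩W (nb∈O i) w)
          distinct i j i≤α j≤α (inj₂ (eq , _)) = pow-distinct H _≡_ sym trans (λ {h} _ → cong (h ·_))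
            mk refl kv i j i≤α j≤α (·-injective p eq)
        dense u (inj₂ (_ , (g , mg , eq) , _)) = nb
          , (λ i _ → apart i , u , nb i , single o
            , subst (λ z → adj G z (nb i) ≡ true)
                (trans (cong (g ·_) (pow-fixed {g = h} hv i)) (sym eq))
                (·-adj g (·-adj (pow h i) (adj-sym {G = G} exv)))
            , inj₁ (nb∈W i , nb∈W i , refl))
          , distinct
          where
          o : O u
          o = g , mg , eq
          nb : ℕ → Fin n
          nb i = g · pow h i · x
          nb∈W : ∀ i → W (nb i)
          nb∈W i = W-inv mg (W-inv (pow-mem mh i) x∈W)
          apart : ∀ i → ¬ R u (nb i)
          apart i (inj₁ (w , _)) = O∩W o w
          apart i (inj₂ (eq , _)) = O∩W o (subst W (sym eq) (nb∈W i))
          f-nb : ∀ i → f (nb i) ≡ g · pow h i · f x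
          f-nb i = trans (f-equi mg (W-inv (pow-mem mh i) x∈W))
              (cong (g ·_) (f-equi (pow-mem mh i) x∈W))
          distinct : ∀ i j → i ≤ α → j ≤ α → R (nb i) (nb j) → i ≡ j
          distinct i j i≤α j≤α (inj₂ (_ , o′ , _)) = ⊥-elim (O∩W o′ (nb∈W i))
          distinct i j i≤α j≤α (inj₁ (_ , _ , eq)) = pow-distinct H _≡_ sym trans
              (λ {h} _ → cong (h ·_))
            mh refl hfx i j i≤α j≤α (·-injective g (trans (sym (f-nb i)) (trans eq (f-nb j))))

    -- Let `h` fix `v` and move `f x`. If some `k` fixes `f x` and moves `v`, then `incomparable`
    -- applies. Otherwise the stabiliser of `f x` lies in that of `v`, and maximality gives the
    -- reverse inclusion.
    attachable : Attachable
    attachable ρ {v} {x} v∈S v∉W x∈W exv {h} mh hv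
      with h · f x ≟ f x
         | search-mem H (λ {g} {k} g≈k (p , q) → trans (sym (g≈k (f x))) p , λ eq → q
             (trans (g≈k v) eq))
             (λ k → (k · f x ≟ f x) ×-dec ¬? (k · v ≟ v))
      where open Retraction ρ
    ... | yes eq | _ = eq
    ... | no hfx | yes (k , mk , kfx , kv) = ⊥-elim (incomparable ρ v∈S v∉W x∈W exv mh hv hfx mk kfx kv)
    ... | no hfx | no none = Fixes-b⇒ ρ v∈S v∉W x∈W exv
      (λ k mk kfx → decidable-stable (k · v ≟ v) λ kv → none (k , mk , kfx , kv)) h mh hv

    maximalRetraction : OrbitRetraction H S S? S-inv S-conn b b∈S
    maximalRetraction = retraction attachable

-- Powers and cyclic subgroups.

module Powers {n : ℕ} (G : Graph n) where

  open GroupAction G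

  pow-+ : ∀ g i j v → pow g (i + j) · v ≡ pow g i · pow g j · v
  pow-+ g zero    j v = refl
  pow-+ g (suc i) j v = cong (g ·_) (pow-+ g i j v)

  pow-comm : ∀ g i j v → pow g i · pow g j · v ≡ pow g j · pow g i · v
  pow-comm g i j v = trans (sym (pow-+ g i j v))
    (trans (cong (λ k → pow g k · v) (+-comm i j)) (pow-+ g j i v))

  pow-reduce : ∀ g i → ∃ λ (j : Fin order) → ∀ v → pow g i · v ≡ pow g (toℕ j) · v
  pow-reduce g zero = fromℕ< 0<order , λ v → cong (λ k → pow g k · v) (sym (toℕ-fromℕ< 0<order))
    where
    0<order : 0 < order
    0<order = ≤-<-trans z≤n (toℕ<n (index ε))
  pow-reduce g (suc i) with pow-reduce g i
  ... | j , eq with m≤n⇒m<n∨m≡n (toℕ<n j)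
  ...   | inj₁ lt = fromℕ< lt , λ v → trans (cong (g ·_) (eq v))
      (cong (λ k → pow g k · v) (sym (toℕ-fromℕ< lt)))
  ...   | inj₂ last with pow-reduce g zero
  ...     | j₀ , eq₀ = j₀ , λ v → trans (cong (g ·_) (eq v))
    (trans (cong (λ k → pow g k · v) last) (trans (pow-order g v) (eq₀ v)))

  pow-inverse : ∀ g i → ∃ λ j → ∀ v → pow g j · pow g i · v ≡ v
  pow-inverse g i with pow-reduce g i
  ... | j , eq = order ∸ toℕ j , λ v → trans (cong (pow g (order ∸ toℕ j) ·_) (eq v))
    (trans (sym (pow-+ g (order ∸ toℕ j) (toℕ j) v))
      (trans (cong (λ k → pow g k · v)
          (trans (+-comm (order ∸ toℕ j) (toℕ j)) (m+[n∸m]≡n (<⇒≤ (toℕ<n j)))))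
        (pow-order g v)))

  search-pow : ∀ g {P : Auto G → Set} → (∀ {g h} → g ≈ h → P g → P h) → Decidable P → Dec
      (∃ λ i → P (pow g i))
  search-pow g resp P? = map′ (λ (i , p) → toℕ i , p)
    (λ (i , p) → let (j , eq) = pow-reduce g i in j , resp {pow g i} {pow g (toℕ j)} eq p)
    (any? λ i → P? (pow g (toℕ i)))

  cyclic : Auto G → Subgroup
  cyclic s = record
    { mem = λ g → ∃ λ i → pow s i ≈ g
    ; mem? = λ g → search-pow s (λ p q v → trans (sym (p v)) (q v)) (λ h → all? λ v → h · v ≟ g · v)
    ; resp = λ g≈h (i , eq) → i , λ v → trans (eq v) (g≈h v)
    ; ε-mem = 0 , λ _ → refl
    ; ∙-mem = λ {g} {h} (i , p) (j , q) → i + j , λ v →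
        trans (pow-+ s i j v) (trans (p _) (cong (g ·_) (q v)))
    ; ⁻¹-mem = λ {g} (i , p) → let (j , q) = pow-inverse s i in j , λ v → trans
        (cong (pow s j ·_) (trans (sym (cancelʳ g v)) (sym (p (g ⁻¹ · v))))) (q (g ⁻¹ · v)) }

-- The action on the orbit of `b` is regular and abelian.

module Regular {n : ℕ} {G : Graph n} (setting : Setting G)
  (H : GroupAction.Subgroup G) (S : Fin n → Set) (S? : Decidable S)
      (S-inv : GroupAction.Invariant G H S)
  (S-conn : GroupAction.Connected G S) (b : Fin n) (b∈S : S b)
  (ρ : Retractions.OrbitRetraction setting H S S? S-inv S-conn b b∈S) where

  open Retractions setting
  open Growth H S S? S-inv S-conn b b∈S (trivialPrecontraction H S b)
  open Powers G
  open Subgroup H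
  open Retraction ρ

  -- `k` stabilises the fibre of `b`, `H` permutes the fibres transitively and `S` is connected, so
  -- `stable-class` reaches every fibre.
  fibre-stable : ∀ {k} → mem k → k · b ≡ b → ∀ {v} → S v → f (k · v) ≡ f v
  fibre-stable {k} m kb sv = proj₂ (proj₂ (stable-class H fibre R-inv R-transitive
    (λ s → s , s , refl) m (S-inv m b∈S , b∈S , cong f kb) (S-conn b∈S sv)))
    where
    open ConnectedPER fibre
    R-inv : Invariant₂ H R
    R-inv {h} mh (p , q , eq) = S-inv mh p , S-inv mh q , trans (f-equi mh p)
        (trans (cong (h ·_) eq) (sym (f-equi mh q)))
    R-transitive : ∀ {v w} → R v v → R w w → ∃ λ h → mem h × R (h · v) w
    R-transitive (p , _) (q , _) with f-orb p | f-orb q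
    ... | g , mg , fv | g′ , mg′ , fw = g′ ∙ g ⁻¹ , m′ , S-inv m′ p , q ,
      trans (f-equi m′ p) (trans (cong (λ z → g′ · g ⁻¹ · z) fv)
          (trans (cong (g′ ·_) (cancelˡ g b)) (sym fw)))
      where
      m′ : mem (g′ ∙ g ⁻¹)
      m′ = ∙-mem mg′ (⁻¹-mem mg)

  -- Regularity: elements that agree at one point of the orbit of `b` agree at all of them. After
  -- conjugation by `h` their quotient fixes `b`, and so it fixes every point of the orbit by
  -- `fibre-stable`.
  agree : ∀ {g g′ h h′} → mem g → mem g′ → mem h → mem h′ →
          g · h · b ≡ g′ · h · b → g · h′ · b ≡ g′ · h′ · b
  agree {g} {g′} {h} {h′} mg mg′ mh mh′ eq = sym (trans (sym (cancelʳ g _)) (cong (g ·_)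
    (trans (cong (λ z → g ⁻¹ · g′ · z) (sym (cancelʳ h _))) (trans (sym (cancelʳ h _))
      (trans (cong (h ·_) fixed) (cancelʳ h _))))))
    where
    k : Auto G
    k = h ⁻¹ ∙ (g ⁻¹ ∙ (g′ ∙ h))
    mk : mem k
    mk = ∙-mem (⁻¹-mem mh) (∙-mem (⁻¹-mem mg) (∙-mem mg′ mh))
    mc : mem (h ⁻¹ ∙ h′)
    mc = ∙-mem (⁻¹-mem mh) mh′
    fixed : k · h ⁻¹ · h′ · b ≡ h ⁻¹ · h′ · b
    fixed = trans (sym (f-orbit-b (∙-mem mk mc)))
      (trans (fibre-stable mk (transpose h (sym (transpose g eq))) (S-inv mc b∈S)) (f-orbit-b mc))

  f-orbit : ∀ {h} → mem h → ∀ {v g} → S v → f v ≡ g · b → f (h · v) ≡ h · g · b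
  f-orbit {h} m s eq = trans (f-equi m s) (cong (h ·_) eq)

  -- The fibres form a Cayley graph of `H` modulo the stabiliser of `b`. The edge from `x` to `y`
  -- makes `s` a connection element, possibly trivial.
  module Edge {s : Auto G} {x y : Fin n} (s∈H : mem s) (x∈S : S x) (y∈S : S y) (exy : adj G x y ≡ true)
    (fx : f x ≡ b) (fy : f y ≡ s · b) where

    pow∈H : ∀ i → mem (pow s i)
    pow∈H = pow-mem s∈H

    -- With the orbit of `b` identified with `H` modulo the stabiliser of `b`, the classes are the
    -- left cosets of the subgroup generated by `s`.
    Coset : Fin n → Fin n → Set
    Coset u w = S u × S w × ∃ λ g → mem g × f u ≡ g · b × ∃ λ i → f w ≡ g · pow s i · b

    Coset? : Decidable₂ Coset
    Coset? u w = S? u ×-dec (S? w ×-dec search-mem H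
      (λ {g} {h} g≈h (p , i , q) → trans p (g≈h b) , i , trans q (g≈h _))
      (λ g → (f u ≟ g · b) ×-dec search-pow s
        (λ {h} {h′} p q → trans q (cong (g ·_) (p b))) (λ h → f w ≟ g · h · b)))

    Coset-sym : Symmetric Coset
    Coset-sym {u} {w} (su , sw , g , mg , p , i , q) = let (j , inv) = pow-inverse s i in
      sw , su , g ∙ pow s i , ∙-mem mg (pow∈H i) , q , j ,
      trans p (cong (g ·_) (trans (sym (inv b)) (pow-comm s j i b)))

    Coset-trans : Transitive Coset
    Coset-trans (su , _ , g , mg , p , i , q) (_ , sw , g′ , mg′ , p′ , j , q′) =
      su , sw , g , mg , p , i + j , trans q′ (trans
        (agree {g′} {g ∙ pow s i} {ε} {pow s j} mg′ (∙-mem mg (pow∈H i)) ε-mem (pow∈H j)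
            (trans (sym p′) q))
        (cong (g ·_) (sym (pow-+ s i j b))))

    Coset-conn : ∀ {u w} → Coset u w → Reach G (Coset u) u w
    Coset-conn {u} (su , sw , g , mg , p , i , q) = walk i sw q
      where
      walk : ∀ i {w} → S w → f w ≡ g · pow s i · b → Reach G (Coset u) u w
      walk zero {w} sw q = reach-map
        (λ (_ , sz , eq) → su , sz , g , mg , p , 0 , trans (sym eq) p)
        (ConnectedPER.R-conn fibre (su , sw , trans p (sym q)))
      -- The edge from `x` to `y`, moved by `g ∙ pow s i`, leads from the fibre with index `i` to
      -- the next one.
      walk (suc i) {w} sw q = reach-trans
        (walk i (S-inv mgi x∈S) (trans (f-equi mgi x∈S) (cong (λ z → g · pow s i · z) fx)))
        (step (·-adj g (·-adj (pow s i) exy)) (su , S-inv mgi y∈S , g , mg , p , suc i , far)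
          (reach-map (λ (_ , sz , eq) → su , sz , g , mg , p , suc i , trans (sym eq) far)
            (ConnectedPER.R-conn fibre (S-inv mgi y∈S , sw , trans far (sym q)))))
        where
        mgi : mem (g ∙ pow s i)
        mgi = ∙-mem mg (pow∈H i)
        far : f (g · pow s i · y) ≡ g · pow s (suc i) · b
        far = trans (f-equi mgi y∈S) (trans (cong (λ z → g · pow s i · z) fy)
          (cong (g ·_) (pow-comm s i 1 b)))

    cosets : ConnectedPER G
    cosets = record
      { R = Coset ; R? = Coset? ; R-sym = λ {u} {w} → Coset-sym {u} {w}
      ; R-trans = λ {u} {v} {w} → Coset-trans {u} {v} {w} ; R-conn = Coset-conn }

    -- The cyclic group generated by s is normal modulo the stabiliser of b.
    opaque
      normal : ∀ {g} → mem g → ∃ λ i → s · g · b ≡ g · pow s i · b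
      normal {g} mg = conclude (Coset-sym (stable-class H cosets Coset-inv Coset-transitive dom s∈H
        (Coset-sym s-class) (S-conn b∈S (S-inv mg b∈S))))
        where
        -- `s` stabilises the coset of `b`, and hence by `stable-class` every left coset; this is
        -- normality.
        s-class : Coset b (s · b)
        s-class = b∈S , S-inv s∈H b∈S , ε , ε-mem , f-b , 1 , f-orbit-b s∈H
        dom : ∀ {w} → S w → Coset w w
        dom sw with f-orb sw
        ... | h , mh , eq = sw , sw , h , mh , eq , 0 , eq
        Coset-inv : Invariant₂ H Coset
        Coset-inv {h} mh (su , sw , g , mg , p , i , q) =
          S-inv mh su , S-inv mh sw , h ∙ g , ∙-mem mh mg , f-orbit mh {g = g} su p , i , f-orbit
              mh {g = g ∙ pow s i} sw q
        Coset-transitive : ∀ {v w} → Coset v v → Coset w w → ∃ λ h → mem h × Coset (h · v) w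
        Coset-transitive (sv , _ , g , mg , p , _) (sw , _ , g′ , mg′ , q , _) = g′ ∙ g ⁻¹ , m′ ,
          S-inv m′ sv , sw , g′ , mg′ , trans (f-orbit m′ {g = g} sv p)
              (cong (g′ ·_) (cancelˡ g b)) , 0 , q
          where
          m′ : mem (g′ ∙ g ⁻¹)
          m′ = ∙-mem mg′ (⁻¹-mem mg)
        conclude : Coset (g · b) (s · g · b) → ∃ λ i → s · g · b ≡ g · pow s i · b
        conclude (_ , _ , g′ , mg′ , p , i , q) = i , trans (sym (f-orbit-b (∙-mem s∈H mg))) (trans q
          (agree {g′} {g} {ε} {pow s i} mg′ mg ε-mem (pow∈H i) (trans (sym p) (f-orbit-b mg))))

    A : Subgroup
    A = cyclic s

    A⊆H : ∀ {g} → Subgroup.mem A g → mem g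
    A⊆H (i , eq) = resp eq (pow∈H i)

    fibres : Precontraction A S b
    fibres = record
      { e = f ; e-in = f-in ; e-equi = λ {h} m → f-equi (A⊆H {h} m) ; e-idem = f-idem ; e-conn =
          f-conn ; e-b = f-b }

    module A-Growth = Growth A S S? (λ {h} m → S-inv (A⊆H {h} m)) S-conn b b∈S fibres

    -- By `agree`, a power of `s` that fixes one point of the orbit of `b` fixes all of them.
    A-attachable : A-Growth.Attachable
    A-attachable ρ′ {v} {x} v∈S _ x∈W _ {h} m eq with f-orb v∈S | A-Growth.Retraction.f-orb ρ′ x∈W
    ... | g , mg , fv | a , ma , fx′ = trans (cong (h ·_) fx′)
      (trans (agree {h} {ε} {g} {a} (A⊆H {h} m) ε-mem mg (A⊆H {a} ma)
          (trans (cong (h ·_) (sym fv)) (trans eq fv))) (sym fx′))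

    opaque
      ρ′ : A-Growth.Retraction S
      ρ′ = A-Growth.retraction A-attachable

    module ρ′ = A-Growth.Retraction ρ′

    module _ {t : Auto G} (t∈H : mem t) where

      conj : ℕ → Auto G
      conj j = (pow t j ∙ s) ∙ (pow t j) ⁻¹

      tʲ∈H : ∀ j → mem (pow t j)
      tʲ∈H = pow-mem t∈H

      conj∈H : ∀ j → mem (conj j)
      conj∈H j = ∙-mem (∙-mem (tʲ∈H j) s∈H) (⁻¹-mem (tʲ∈H j))

      t⁻¹∈H : mem (t ⁻¹)
      t⁻¹∈H = ⁻¹-mem t∈H

      opaque
        -- Conjugation by `t` raises the index by one and respects agreement at `b`, so
        -- `distinct-orbit` applies. The first step is not trivial because `t` and `s` do not
        -- commute at `b`.
        conj-distinct : t · s · b ≢ s · t · b →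
                        ∀ i j → i ≤ α → j ≤ α → conj i · b ≡ conj j · b → i ≡ j
        conj-distinct tsb≢stb i j i≤α j≤α = distinct-orbit (λ u v → conj u · b ≡ conj v · b) sym
            trans (λ k → k)
          (λ u v eq → cong (t ·_) (agree {conj u} {conj v} {ε} {t ⁻¹} (conj∈H u) (conj∈H v) ε-mem
              t⁻¹∈H eq))
          (λ u v eq → agree {conj u} {conj v} {t ⁻¹} {ε} (conj∈H u) (conj∈H v) t⁻¹∈H ε-mem
              (·-injective t eq))
          order
          (trans (pow-order t _) (cong (s ·_) (trans (sym (pow-order t _)) (cancelʳ (pow t order) b))))
          (λ eq → tsb≢stb (trans (cong (λ z → t · s · z) (sym (cancelˡ t b)))
            (agree {conj 1} {s} {ε} {t} (conj∈H 1) s∈H ε-mem t∈H eq)))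
          α coprime i j i≤α j≤α

        conj-power : ∀ j → ∃ λ i → conj j · b ≡ pow s i · b
        conj-power j with normal (⁻¹-mem (tʲ∈H j))
        ... | i , eq = i , trans (cong (pow t j ·_) eq) (cancelʳ (pow t j) _)

      -- The classes of ρ′ are permuted regularly by the powers of s; each of them meets
      -- the A-orbit of t^j b and so is adjacent to its image under conj j.
      commute : t · s · b ≡ s · t · b
      commute = decidable-stable (t · s · b ≟ s · t · b) λ tsb≢stb →
        sparse ρ′.fibre b (b∈S , b∈S , refl) (λ u (su , _) → dense tsb≢stb u su)
        where
        open ConnectedPER ρ′.fibre using (R; Adjacent)
        dense : t · s · b ≢ s · t · b → ∀ u → S u → ∃ λ (nb : ℕ → Fin n) →
          (∀ i → i ≤ α → Adjacent u (nb i)) × (∀ i j → i ≤ α → j ≤ α → R (nb i) (nb j) → i ≡ j)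
        dense tsb≢stb u su with ρ′.f-orb su
        ... | a , ma , fu = nb
          , (λ j _ → apart j , c j · pow t j · x , nb j ,
              (su , S-inv (cʲ∈H j) x∈S , trans fu (sym (near j)))
              , ·-adj (c j) (·-adj (pow t j) exy) , (nb∈S j , nb∈S j , refl))
          , λ i j i≤α j≤α (_ , _ , eq) → conj-distinct tsb≢stb i j i≤α j≤α
              (agree {conj i} {conj j} {a} {ε} (conj∈H i) (conj∈H j) (A⊆H {a} ma) ε-mem
                  (trans (sym (far i)) (trans eq (far j))))
          where
          tʲb∈S : ∀ j → S (pow t j · b)
          tʲb∈S j = S-inv (tʲ∈H j) b∈S
          a′ : ∀ j → ∃ λ g → Subgroup.mem A g × ρ′.f (pow t j · b) ≡ g · b
          a′ j = ρ′.f-orb (tʲb∈S j)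
          -- `c j` is the element of `A` that carries the class of `pow t j · b` onto the class of
          -- `u`; it commutes with the powers of `s`, as used in `far`.
          c : ℕ → Auto G
          c j = a ∙ (proj₁ (a′ j)) ⁻¹
          c∈A : ∀ j → Subgroup.mem A (c j)
          c∈A j = Subgroup.∙-mem A {a} {proj₁ (a′ j) ⁻¹} ma
              (Subgroup.⁻¹-mem A {proj₁ (a′ j)} (proj₁ (proj₂ (a′ j))))
          cʲ∈H : ∀ j → mem (c j ∙ pow t j)
          cʲ∈H j = ∙-mem (A⊆H {c j} (c∈A j)) (tʲ∈H j)
          nb : ℕ → Fin n
          nb j = c j · pow t j · y
          nb∈S : ∀ j → S (nb j)
          nb∈S j = S-inv (cʲ∈H j) y∈S
          c-cancel : ∀ j → c j · ρ′.f (pow t j · b) ≡ a · b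
          c-cancel j = trans (cong (c j ·_) (proj₂ (proj₂ (a′ j))))
              (cong (a ·_) (cancelˡ (proj₁ (a′ j)) b))
          near : ∀ j → ρ′.f (c j · pow t j · x) ≡ a · b
          near j = trans (ρ′.f-equi {c j} (c∈A j) (S-inv (tʲ∈H j) x∈S)) (trans
            (cong (c j ·_) (trans (sym (ρ′.f-e (S-inv (tʲ∈H j) x∈S)))
              (cong ρ′.f (trans (f-equi (tʲ∈H j) x∈S) (cong (pow t j ·_) fx)))))
            (c-cancel j))
          far : ∀ j → ρ′.f (nb j) ≡ conj j · a · b
          far j with conj-power j
          ... | i , conj≡ = begin
            ρ′.f (c j · pow t j · y)         ≡⟨ ρ′.f-equi {c j} (c∈A j) (S-inv (tʲ∈H j) y∈S) ⟩
            c j · ρ′.f (pow t j · y)         ≡⟨ cong (c j ·_) (ρ′.f-e (S-inv (tʲ∈H j) y∈S)) ⟨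
            c j · ρ′.f (f (pow t j · y))     ≡⟨ cong (λ z → c j · ρ′.f z) at-y ⟩
            c j · ρ′.f (pow s i · pow t j · b) ≡⟨ cong (c j ·_)
                (ρ′.f-equi {pow s i} (i , λ _ → refl) (tʲb∈S j)) ⟩
            c j · pow s i · ρ′.f (pow t j · b) ≡⟨ proj₂ (c∈A j) _ ⟨
            pow s k · pow s i · ρ′.f (pow t j · b) ≡⟨ pow-comm s k i _ ⟩
            pow s i · pow s k · ρ′.f (pow t j · b) ≡⟨ cong (pow s i ·_) (proj₂ (c∈A j) _) ⟩
            pow s i · c j · ρ′.f (pow t j · b) ≡⟨ cong (pow s i ·_) (c-cancel j) ⟩
            pow s i · a · b                  ≡⟨ agree {conj j} {pow s i} {ε} {a} (conj∈H j)
                (pow∈H i) ε-mem (A⊆H {a} ma) conj≡ ⟨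
            conj j · a · b                   ∎
            where
            open ≡-Reasoning
            k = proj₁ (c∈A j)
            at-y : f (pow t j · y) ≡ pow s i · pow t j · b
            at-y = trans (f-equi (tʲ∈H j) y∈S)
                (trans (cong (pow t j ·_) (trans fy (cong (s ·_) (sym (cancelˡ (pow t j) b)))))
              (agree {conj j} {pow s i} {ε} {pow t j} (conj∈H j) (pow∈H i) ε-mem (tʲ∈H j) conj≡))
          -- If `conj j` fixed `a · b`, then `s` would fix `b`, hence the whole orbit, and would
          -- commute with `t` there.
          apart : ∀ j → ¬ R u (nb j)
          apart j (_ , _ , eq) = tsb≢stb (trans (cong (t ·_) sb)
              (sym (agree {s} {ε} {ε} {t} s∈H ε-mem ε-mem t∈H sb)))
            where
            conj-trivial : conj j · a · b ≡ a · b
            conj-trivial = trans (sym (far j)) (trans (sym eq) fu)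
            sb : s · b ≡ b
            sb = trans (cong (s ·_) (sym (cancelˡ (pow t j) b))) (·-injective (pow t j)
              (agree {conj j} {ε} {a} {pow t j} (conj∈H j) ε-mem (A⊆H {a} ma) (tʲ∈H j) conj-trivial))

  Central : Auto G → Set
  Central g = ∀ {t} → mem t → t · g · b ≡ g · t · b

  -- Centrality modulo the stabiliser of `b` spreads along a walk: for adjacent `u` and `w` over
  -- `g · b` and `g′ · b`, the quotient `g ⁻¹ ∙ g′` is a connection element, hence central by
  -- `Edge.commute`.
  abelian-orbit : ∀ {g h} → mem g → mem h → g · h · b ≡ h · g · b
  abelian-orbit {g} {h} mg mh = proj₂
      (reach-closed {Q = λ u → S u × (∀ {g} → mem g → f u ≡ g · b → Central g)}
      (λ { {u} {w} (su , central) e sw → sw , λ {g′} mg′ fw → next su sw e central mg′ fw })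
      (b∈S , λ {g} mg eq {t} mt → trans (cong (t ·_) (sym (trans (sym f-b) eq)))
        (agree {ε} {g} {ε} {t} ε-mem mg ε-mem mt (trans (sym f-b) eq)))
      (S-conn b∈S (S-inv mh b∈S))) mh (f-orbit-b mh) mg
    where
    next : ∀ {u w} → S u → S w → adj G u w ≡ true → (∀ {g} → mem g → f u ≡ g · b → Central g) →
           ∀ {g′} → mem g′ → f w ≡ g′ · b → Central g′
    next {u} {w} su sw e central {g′} mg′ fw {t} mt with f-orb su
    ... | g , mg , fu = begin
      t · g′ · b          ≡⟨ cong (t ·_) (cancelʳ g (g′ · b)) ⟨
      t · g · s · b       ≡⟨ agree {t ∙ g} {g ∙ t} {ε} {s} (∙-mem mt mg) (∙-mem mg mt) ε-mem ms
          (central mg fu mt) ⟩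
      g · t · s · b       ≡⟨ cong (g ·_) (Edge.commute ms (S-inv (⁻¹-mem mg) su) (S-inv (⁻¹-mem mg) sw)
                               (·-adj (g ⁻¹) e) fx (f-orbit (⁻¹-mem mg) {g = g′} sw fw) mt) ⟩
      g · s · t · b       ≡⟨ cancelʳ g _ ⟩
      g′ · t · b          ∎
      where
      open ≡-Reasoning
      s : Auto G
      s = g ⁻¹ ∙ g′
      ms : mem s
      ms = ∙-mem (⁻¹-mem mg) mg′
      fx : f (g ⁻¹ · u) ≡ b
      fx = trans (f-orbit (⁻¹-mem mg) {g = g} su fu) (cancelˡ g b)

-- Deciding reachability; components of induced subgraphs.

module Reachability {n : ℕ} (G : Graph n) where

  opaque
    reach? : {S : Fin n → Set} → Decidable S → ∀ v w → Dec (Reach G S v w)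
    reach? {S} S? v w =
      let (C , C? , sound , complete) = explore (v ≟_) (λ { refl → here }) refl (<-wellFounded _)
      in map′ sound complete (C? w)
      where
      explore : {C : Fin n → Set} (C? : Decidable C) → (∀ {w} → C w → Reach G S v w) → C v →
                Acc _<_ (count (λ w → ¬? (C? w))) →
                ∃ λ (C : Fin n → Set) → Decidable C × (∀ {w} → C w → Reach G S v w) ×
                    (∀ {w} → Reach G S v w → C w)
      explore {C} C? sound cv (acc rec) with any? (λ u → any? λ w →
        C? u ×-dec (¬? (C? w) ×-dec ((adj G u w Bool.≟ true) ×-dec S? w)))
      ... | no none = C , C? , sound , reach-closed
        (λ {u} {w} cu e sw → decidable-stable (C? w) λ ¬cw → none (u , w , cu , ¬cw , e , sw)) cv
      ... | yes (u , w , cu , ¬cw , e , sw) = explore {λ z → C z ⊎ w ≡ z} C⁺?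
        (λ { (inj₁ cz) → sound cz ; (inj₂ refl) → reach-trans (sound cu) (step e sw here) }) (inj₁ cv)
        (rec (count-< (λ z → ¬? (C⁺? z)) (λ z → ¬? (C? z)) (λ ¬c cz → ¬c (inj₁ cz)) w
            (λ ¬c → ¬c (inj₂ refl)) ¬cw))
        where
        C⁺? : Decidable (λ z → C z ⊎ w ≡ z)
        C⁺? z = C? z ⊎-dec (w ≟ z)

  component-connected : ∀ {S : Fin n → Set} {v} → S v → ∀ {u w} → Reach G S v u → Reach G S v w →
                        Reach G (Reach G S v) u w
  component-connected {S} {v} sv {u} {w} ru rw = proj₂ (reach-closed
    {Q = λ z → Reach G S v z × Reach G (Reach G S v) u z}
    (λ (rz , p) e s → let rz′ = reach-trans rz (step e s here) in rz′ , reach-trans p (step e rz′ here))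
    (ru , here) (reach-trans (reach-sym sv ru) rw))

-- Pointwise stabilisers do not move components.

module Components {n : ℕ} {G : Graph n} (setting : Setting G) where

  open Retractions setting public
  open Powers G public
  open Reachability G public

  supported : {S : Fin n → Set} → Decidable S → Subgroup
  supported {S} S? = record
    { mem = λ g → ∀ v → ¬ S v → g · v ≡ v
    ; mem? = λ g → all? λ v → ¬? (S? v) →-dec (g · v ≟ v)
    ; resp = λ g≈h p v ¬s → trans (sym (g≈h v)) (p v ¬s)
    ; ε-mem = λ _ _ → refl
    ; ∙-mem = λ {g} p q v ¬s → trans (cong (g ·_) (q v ¬s)) (p v ¬s)
    ; ⁻¹-mem = λ {g} p v ¬s → transpose g (p v ¬s) }

  supported-inv : {S : Fin n → Set} (S? : Decidable S) → Invariant (supported S?) S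
  supported-inv {S} S? {g} {v} m s = decidable-stable (S? (g · v)) λ ¬s →
    ¬s (subst S (sym (·-injective g (m (g · v) ¬s))) s)

  SupportRetraction : {S : Fin n → Set} → Decidable S → Connected S → ∀ b → S b → Set
  SupportRetraction {S} S? S-conn b b∈S =
    OrbitRetraction (supported S?) S S? (λ {g} → supported-inv S? {g}) S-conn b b∈S

  -- The exponents `i` for which `pow τ i` fixes `v` include 2 and the group order, which are
  -- coprime.
  involution-trivial : ∀ τ → (∀ v → τ · τ · v ≡ v) → ∀ v → τ · v ≡ v
  involution-trivial τ ττ v = coprime-period {λ i → pow τ i · v ≡ v} refl
    (λ {i} {j} p q → trans (pow-+ τ i j v) (trans (cong (pow τ i ·_) q) p))
    (λ {i} {j} p q → trans (cong (pow τ i ·_) (sym q)) (trans (sym (pow-+ τ i j v)) p))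
    odd (ττ v) (pow-order τ v)

  -- If k moved the component of v to another one, exchanging the two components by
  -- means of k would be an automorphism of order 2.
  component-stable : ∀ {R : Fin n → Set} (R? : Decidable R) {k} → Subgroup.mem (supported R?) k →
                     ∀ {v} → R v → Reach G R v (k · v)
  component-stable {R} R? {k} m {v} rv = decidable-stable (reach? R? v (k · v)) λ apart →
    apart (subst (Reach G R v) (sym (fixed apart)) here)
    where
    D D′ : Fin n → Set
    D  = Reach G R v
    D′ = Reach G R (k · v)
    rkv : R (k · v)
    rkv = supported-inv R? {k} m rv
    D⊆R : ∀ {w} → D w → R w
    D⊆R = reach-end rv
    D′⊆R : ∀ {w} → D′ w → R w
    D′⊆R = reach-end rkv
    k-D : ∀ {w} → D w → D′ (k · w)
    k-D = reach-· k (supported-inv R? {k} m)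
    k⁻¹-D′ : ∀ {w} → D′ w → D (k ⁻¹ · w)
    k⁻¹-D′ {w} r = subst (λ z → Reach G R z (k ⁻¹ · w)) (cancelˡ k v)
      (reach-· (k ⁻¹) (supported-inv R? {k ⁻¹} (Subgroup.⁻¹-mem (supported R?) {k} m)) r)
    nonadjacent : {X : Fin n → Set} → (∀ {u w} → X u → adj G u w ≡ true → R w → X w) →
                  ∀ {u w} → X u → R w → ¬ X w → adj G u w ≡ false
    nonadjacent closed {u} {w} xu rw ¬xw with adj G u w in e
    ... | true  = ⊥-elim (¬xw (closed xu e rw))
    ... | false = refl
    grow : ∀ {z u w} → Reach G R z u → adj G u w ≡ true → R w → Reach G R z w
    grow r e rw = reach-trans r (step e rw here)
    module _ (apart : ¬ D (k · v)) where
      disjoint : ∀ {w} → D w → ¬ D′ w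
      disjoint d d′ = apart (reach-trans d (reach-sym rkv d′))
      -- The graph of the exchange map as a relation, so that its properties follow by cases on the
      -- places of the vertices.
      data Place (w : Fin n) : Fin n → Set where
        inD  : D w → Place w (k · w)
        inD′ : D′ w → Place w (k ⁻¹ · w)
        out  : ¬ D w → ¬ D′ w → Place w w
      place : ∀ w → ∃ (Place w)
      place w with reach? R? v w | reach? R? (k · v) w
      ... | yes d | _      = _ , inD d
      ... | no _  | yes d′ = _ , inD′ d′
      ... | no ¬d | no ¬d′ = _ , out ¬d ¬d′
      unique : ∀ {w x y} → Place w x → Place w y → x ≡ y
      unique (inD d)     (inD _)     = refl
      unique (inD d)     (inD′ d′)   = ⊥-elim (disjoint d d′)
      unique (inD d)     (out ¬d _)  = ⊥-elim (¬d d)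
      unique (inD′ d′)   (inD d)     = ⊥-elim (disjoint d d′)
      unique (inD′ d′)   (inD′ _)    = refl
      unique (inD′ d′)   (out _ ¬d′) = ⊥-elim (¬d′ d′)
      unique (out ¬d _)  (inD d)     = ⊥-elim (¬d d)
      unique (out _ ¬d′) (inD′ d′)   = ⊥-elim (¬d′ d′)
      unique (out _ _)   (out _ _)   = refl
      back : ∀ {w x} → Place w x → Place x w
      back {w} (inD d)         = subst (Place (k · w)) (cancelˡ k w) (inD′ (k-D d))
      back {w} (inD′ d′)       = subst (Place (k ⁻¹ · w)) (cancelʳ k w) (inD (k⁻¹-D′ d′))
      back (out ¬d ¬d′) = out ¬d ¬d′
      swap : Fin n → Fin n
      swap w = proj₁ (place w)
      swap-swap : ∀ w → swap (swap w) ≡ w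
      swap-swap w = unique (proj₂ (place (swap w))) (back (proj₂ (place w)))
      -- If `w` lies in `R`, both sides are false, since `w` lies in neither component; otherwise
      -- `k` fixes `w`.
      D-out : ∀ {u w} → D u → ¬ D w → ¬ D′ w → adj G (k · u) w ≡ adj G u w
      D-out {u} {w} d ¬d ¬d′ with R? w
      ... | yes rw = trans (nonadjacent grow (k-D d) rw ¬d′) (sym (nonadjacent grow d rw ¬d))
      ... | no ¬rw = trans (cong (adj G (k · u)) (sym (m w ¬rw))) (preserve k u w)
      D′-out : ∀ {u w} → D′ u → ¬ D w → ¬ D′ w → adj G (k ⁻¹ · u) w ≡ adj G u w
      D′-out {u} {w} d′ ¬d ¬d′ =
        trans (sym (D-out (k⁻¹-D′ d′) ¬d ¬d′)) (cong (λ z → adj G z w) (cancelʳ k u))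
      D-D′ : ∀ {u w} → D u → D′ w → adj G (k · u) (k ⁻¹ · w) ≡ adj G u w
      D-D′ d d′ = trans (nonadjacent grow (k-D d) (D⊆R (k⁻¹-D′ d′)) (disjoint (k⁻¹-D′ d′)))
                        (sym (nonadjacent grow d (D′⊆R d′) λ d → disjoint d d′))
      flip : ∀ {u w u′ w′} → adj G w′ u′ ≡ adj G w u → adj G u′ w′ ≡ adj G u w
      flip {u} {w} {u′} {w′} eq = trans (Graph.sym G u′ w′) (trans eq (Graph.sym G w u))
      swap-adj : ∀ {u w u′ w′} → Place u u′ → Place w w′ → adj G u′ w′ ≡ adj G u w
      swap-adj (inD d)       (inD e)       = preserve k _ _
      swap-adj (inD d)       (inD′ e)      = D-D′ d e
      swap-adj (inD d)       (out ¬e ¬e′)  = D-out d ¬e ¬e′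
      swap-adj (inD′ d)      (inD e)       = flip (D-D′ e d)
      swap-adj (inD′ d)      (inD′ e)      = preserve (k ⁻¹) _ _
      swap-adj (inD′ d)      (out ¬e ¬e′)  = D′-out d ¬e ¬e′
      swap-adj (out ¬d ¬d′)  (inD e)       = flip (D-out e ¬d ¬d′)
      swap-adj (out ¬d ¬d′)  (inD′ e)      = flip (D′-out e ¬d ¬d′)
      swap-adj (out _ _)     (out _ _)     = refl
      τ : Auto G
      τ = record { perm = permutation swap swap swap-swap swap-swap
                 ; preserve = λ u w → swap-adj (proj₂ (place u)) (proj₂ (place w)) }
      fixed : k · v ≡ v
      fixed = trans (unique (inD here) (proj₂ (place v))) (involution-trivial τ swap-swap v)

-- The vertices moved by the stabiliser of `b`.

module Residual {n : ℕ} {G : Graph n} (setting : Setting G)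
  (H : GroupAction.Subgroup G) (S : Fin n → Set) (S? : Decidable S)
      (S-inv : GroupAction.Invariant G H S)
  (S-conn : GroupAction.Connected G S)
  (H-supp : ∀ {g} → GroupAction.Subgroup.mem H g → GroupAction.Subgroup.mem
      (Components.supported setting S?) g)
  (b : Fin n) (b∈S : S b)
  (ρ : Retractions.OrbitRetraction setting H S S? S-inv S-conn b b∈S) where

  open Components setting
  open Growth H S S? S-inv S-conn b b∈S (trivialPrecontraction H S b)
  open Subgroup H
  open Retraction ρ
  open Regular setting H S S? S-inv S-conn b b∈S ρ public

  Stab : Subgroup
  Stab = record
    { mem = λ g → mem g × g · b ≡ b
    ; mem? = λ g → mem? g ×-dec (g · b ≟ b)
    ; resp = λ g≈h (m , eq) → resp g≈h m , trans (sym (g≈h b)) eq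
    ; ε-mem = ε-mem , refl
    ; ∙-mem = λ {g} (m , p) (m′ , q) → ∙-mem m m′ , trans (cong (g ·_) q) p
    ; ⁻¹-mem = λ {g} (m , p) → ⁻¹-mem m , transpose g p }

  Rest : Fin n → Set
  Rest v = S v × ¬ Fixes H b v

  Rest? : Decidable Rest
  Rest? v = S? v ×-dec ¬? (Fixes? H b v)

  b∉Rest : ¬ Rest b
  b∉Rest (_ , ¬fix) = ¬fix λ _ _ eq → eq

  K-supported : ∀ {k} → Subgroup.mem Stab k → Subgroup.mem (supported Rest?) k
  K-supported {k} (m , kb) v ¬r with S? v | Fixes? H b v
  ... | no ¬s | _       = H-supp m v ¬s
  ... | yes s | yes fix = fix k m kb
  ... | yes s | no ¬fix = ⊥-elim (¬r (s , ¬fix))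

  -- The stabiliser of `b` is normal: by `agree` its elements fix `ℓ · b` as well, so their
  -- conjugates by `ℓ` fix `b`.
  fix-inv : ∀ {ℓ v} → mem ℓ → Fixes H b v → Fixes H b (ℓ · v)
  fix-inv {ℓ} {v} m fix k mk kb = trans (sym (cancelʳ ℓ _)) (cong (ℓ ·_)
    (fix ((ℓ ⁻¹ ∙ k) ∙ ℓ) (∙-mem (∙-mem (⁻¹-mem m) mk) m)
      (transpose ℓ (sym (agree {k} {ε} {ε} {ℓ} mk ε-mem ε-mem m kb)))))

  Rest-inv : Invariant H Rest
  Rest-inv {ℓ} {v} m (s , ¬fix) = S-inv m s , λ fix → ¬fix
      (subst (Fixes H b) (cancelˡ ℓ v) (fix-inv (⁻¹-mem m) fix))

  -- Otherwise a walk in `S` from `v` to `b` would never leave `Rest`, which does not contain `b`.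
  boundary : ∀ {v} → Rest v → ∃ λ w → ∃ λ u → Reach G Rest v w × adj G w u ≡ true × S u × Fixes H b u
  boundary {v} rv = decidable-stable
    (any? λ w → any? λ u → reach? Rest? v w ×-dec
        ((adj G w u Bool.≟ true) ×-dec (S? u ×-dec Fixes? H b u)))
    λ none → b∉Rest (proj₁ (reach-closed {Q = λ w → Rest w × Reach G Rest v w}
      (λ {w} {u} (rw , r) e su → let ru = su , λ fix → none (w , u , r , e , su , fix) in
        ru , reach-trans r (step e ru here)) (rv , here) (S-conn (proj₁ rv) b∈S)))

  module Component {v : Fin n} (v∈R : Rest v) where

    D : Fin n → Set
    D = Reach G Rest v

    D⊆R : ∀ {w} → D w → Rest w
    D⊆R = reach-end v∈R

    D-inv : Invariant Stab D
    D-inv {k} m d = reach-trans d (component-stable Rest? {k} (K-supported {k} m) (D⊆R d))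

    -- Contracting D along a retraction for Stab gives a complete bipartite minor between
    -- the orbit of c under Stab and the orbit of u under ℓ, both of size greater than α.
    module _ {c : Fin n} (c∈D : D c)
      (σ : OrbitRetraction Stab D (reach? Rest? v) (λ {k} → D-inv {k}) (component-connected v∈R) c c∈D)
      {k : Auto G} (k∈K : Subgroup.mem Stab k) (kc≢c : k · c ≢ c)
      {u w : Fin n} (w∈D : D w) (ewu : adj G w u ≡ true) (u∈S : S u) (u-fix : Fixes H b u)
      {ℓ : Auto G} (ℓ∈H : mem ℓ) (ℓ-D : ∀ {z} → D z → D (ℓ · z)) where

      module σ = Growth.Retraction σ

      orbit-fixed : ℓ · u ≡ u
      orbit-fixed = decidable-stable (ℓ · u ≟ u) λ ℓu≢u → sparse C c (inj₁ (c∈D , c∈D , refl))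
          (dense ℓu≢u)
        where
        O : Fin n → Set
        O z = ∃ λ i → pow ℓ i · u ≡ z
        O? : Decidable O
        O? z = search-pow ℓ (λ g≈h eq → trans (sym (g≈h u)) eq) (λ g → g · u ≟ z)
        C : ConnectedPER G
        C = withSingletons σ.fibre O?
        open ConnectedPER C using (R; Adjacent)
        uᵢ : ℕ → Fin n
        uᵢ i = pow ℓ i · u
        uᵢ-fix : ∀ i → Fixes H b (uᵢ i)
        uᵢ-fix i = fix-inv (pow-mem ℓ∈H i) u-fix
        uᵢ∉D : ∀ i → ¬ D (uᵢ i)
        uᵢ∉D i d = proj₂ (D⊆R d) (uᵢ-fix i)
        single : ∀ i → R (uᵢ i) (uᵢ i)
        single i = inj₂ (refl , (i , refl) , λ (d , _) → uᵢ∉D i d)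
        wᵢ∈D : ∀ i → D (pow ℓ i · w)
        wᵢ∈D zero    = w∈D
        wᵢ∈D (suc i) = ℓ-D (wᵢ∈D i)
        -- Being in `Stab`, `p` fixes `uᵢ i`, while it moves the other end of the edge into the
        -- class of `q · c`. So every class is adjacent to every `uᵢ i`.
        meets : ∀ i {q} → Subgroup.mem Stab q → ∃ λ p → D p × adj G p (uᵢ i) ≡ true × σ.f p ≡ q · c
        meets i {q} mq with σ.f-orb (wᵢ∈D i)
        ... | a , ma , eq = p · pow ℓ i · w , D-inv {p} mp (wᵢ∈D i)
          , subst (λ z → adj G (p · pow ℓ i · w) z ≡ true) (uᵢ-fix i p (proj₁ mp) (proj₂ mp))
              (·-adj p (·-adj (pow ℓ i) ewu))
          , trans (σ.f-equi {p} mp (wᵢ∈D i)) (trans (cong (p ·_) eq) (cong (q ·_) (cancelˡ a c)))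
          where
          p : Auto G
          p = q ∙ a ⁻¹
          mp : Subgroup.mem Stab p
          mp = Subgroup.∙-mem Stab {q} {a ⁻¹} mq (Subgroup.⁻¹-mem Stab {a} ma)
        dense : ℓ · u ≢ u → ∀ z → R z z → ∃ λ (nb : ℕ → Fin n) → (∀ i → i ≤ α → Adjacent z (nb i)) ×
                (∀ i j → i ≤ α → j ≤ α → R (nb i) (nb j) → i ≡ j)
        dense ℓu≢u z (inj₁ (z∈D , _)) with σ.f-orb z∈D
        ... | q , mq , fz = uᵢ
          , (λ i _ → apart i , (let (p , p∈D , e , fp) = meets i {q} mq in
              p , uᵢ i , inj₁ (z∈D , p∈D , trans fz (sym fp)) , e , single i))
          , distinct
          where
          apart : ∀ i → ¬ R z (uᵢ i)
          apart i (inj₁ (_ , d , _)) = uᵢ∉D i d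
          apart i (inj₂ (eq , _))    = uᵢ∉D i (subst D eq z∈D)
          distinct : ∀ i j → i ≤ α → j ≤ α → R (uᵢ i) (uᵢ j) → i ≡ j
          distinct i j i≤α j≤α (inj₁ (d , _)) = ⊥-elim (uᵢ∉D i d)
          distinct i j i≤α j≤α (inj₂ (eq , _)) =
            pow-distinct H _≡_ sym trans (λ {h} _ → cong (h ·_)) ℓ∈H refl ℓu≢u i j i≤α j≤α eq
        dense ℓu≢u _ (inj₂ (_ , (i , refl) , _)) = nb
          , (λ j _ → apart j , (let (p , p∈D , e , fp) = meets i {pow k j} (kʲ∈K j) in
              uᵢ i , p , single i , adj-sym {G = G} e , inj₁ (p∈D , nb∈D j , trans fp (sym (f-nb j)))))
          , distinct
          where
          kʲ∈K : ∀ j → Subgroup.mem Stab (pow k j)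
          kʲ∈K = Subgroup.pow-mem Stab k∈K
          nb : ℕ → Fin n
          nb j = pow k j · c
          nb∈D : ∀ j → D (nb j)
          nb∈D j = D-inv {pow k j} (kʲ∈K j) c∈D
          f-nb : ∀ j → σ.f (nb j) ≡ nb j
          f-nb j = σ.f-orbit-b {pow k j} (kʲ∈K j)
          apart : ∀ j → ¬ R (uᵢ i) (nb j)
          apart j (inj₁ (d , _))  = uᵢ∉D i d
          apart j (inj₂ (eq , _)) = uᵢ∉D i (subst D (sym eq) (nb∈D j))
          distinct : ∀ i j → i ≤ α → j ≤ α → R (nb i) (nb j) → i ≡ j
          distinct i j i≤α j≤α (inj₁ (_ , _ , eq)) =
            pow-distinct Stab _≡_ sym trans (λ {h} _ → cong (h ·_)) {k} k∈K refl kc≢c i j i≤α j≤α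
              (trans (sym (f-nb i)) (trans eq (f-nb j)))
          distinct i′ j i≤α j≤α (inj₂ (_ , _ , ¬d)) = ⊥-elim (¬d (nb∈D i′ , nb∈D i′ , refl))

  opaque
    -- Retract the component of `v` onto the `Stab`-orbit of a suitable `c`, which is moved by
    -- `Stab` because it lies in `Rest`. Then `orbit-fixed` makes `ℓ` fix a vertex `u` bordering the
    -- component; so `ℓ` fixes `f u`, a point of the orbit of `b`, and by `agree` also `b`.
    component-stabiliser : ∀ {ℓ v} → mem ℓ → Rest v → Reach G Rest v (ℓ · v) → ℓ · b ≡ b
    component-stabiliser {ℓ} {v} m r vℓv =
      let (c , c∈D , c-max) = maximalStabiliser Stab (reach? Rest? v) v here
          (k , mk , kb , kc) = mover (proj₂ (C.D⊆R c∈D))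
          (w , u , w∈D , e , u∈S , fix) = boundary r
          (g , mg , fu) = f-orb u∈S
          ℓu≡u = C.orbit-fixed c∈D
            (Maximal.maximalRetraction Stab C.D (reach? Rest? v) (λ {k} → C.D-inv {k})
                (component-connected r) c c∈D c-max)
            {k} (mk , kb) kc w∈D e u∈S fix m
            (λ d → reach-trans vℓv (reach-· ℓ (Rest-inv m) d))
      in agree {ℓ} {ε} {g} {ε} m ε-mem mg ε-mem
           (trans (cong (ℓ ·_) (sym fu)) (trans (sym (f-equi m u∈S)) (trans (cong f ℓu≡u) fu)))
      where
      module C = Component r
      mover : ∀ {c} → ¬ Fixes H b c → ∃ λ k → mem k × k · b ≡ b × k · c ≢ c
      mover {c} ¬fix = decidable-stable
        (search-mem H (λ {g} {h} g≈h (p , q) → trans (sym (g≈h b)) p , λ eq → q (trans (g≈h c) eq))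
          (λ k → (k · b ≟ b) ×-dec ¬? (k · c ≟ c)))
        λ none → ¬fix λ k mk kb → decidable-stable (k · c ≟ c) λ kc → none (k , mk , kb , kc)

-- Isomorphisms of groups.

bijectiveHomomorphism : (A B : Group 0ℓ 0ℓ) → let module A = Group A; module B = Group B in
  (f : A.Carrier → B.Carrier) → (∀ {x y} → x A.≈ y → f x B.≈ f y) →
  (∀ x y → f (x A.∙ y) B.≈ f x B.∙ f y) → (∀ {x y} → f x B.≈ f y → x A.≈ y) →
  (∀ y → ∃ λ x → f x B.≈ y) → A ≅ B
bijectiveHomomorphism A B f f-cong f-∙ f-injective f-surjective = f , record
  { isGroupMonomorphism = record
    { isGroupHomomorphism = record
      { isMonoidHomomorphism = record
        { isMagmaHomomorphism = record { isRelHomomorphism = record { cong = f-cong } ; homo = f-∙ }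
        ; ε-homo = f-ε }
      ; ⁻¹-homo = λ x → BP.inverseˡ-unique _ _
          (B.trans (B.sym (f-∙ (x A.⁻¹) x)) (B.trans (f-cong (A.inverseˡ x)) f-ε)) }
    ; injective = f-injective }
  ; surjective = λ y → let (x , eq) = f-surjective y in x , λ z≈x → B.trans (f-cong z≈x) eq }
  where
  module A = Group A
  module B = Group B
  module BP = GP B
  f-ε : f A.ε B.≈ B.ε
  f-ε = BP.identityˡ-unique _ _ (B.trans (B.sym (f-∙ A.ε A.ε)) (f-cong (A.identityˡ A.ε)))

≅-sym : ∀ {A B} → A ≅ B → B ≅ A
≅-sym {A} {B} (f , f-iso) = bijectiveHomomorphism B A g
  (λ eq → injective (B.trans (f-g _) (B.trans eq (B.sym (f-g _)))))
  (λ x y → injective (B.trans (f-g _)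
      (B.sym (B.trans (IsGroupHomomorphism.homo isGroupHomomorphism (g x) (g y))
          (B.∙-cong (f-g x) (f-g y))))))
  (λ eq → B.trans (B.sym (f-g _)) (B.trans (⟦⟧-cong eq) (f-g _)))
  (λ x → f x , injective (f-g (f x)))
  where
  module A = Group A
  module B = Group B
  open GroupMorphisms A.rawGroup B.rawGroup
  open IsGroupIsomorphism f-iso
  g : B.Carrier → A.Carrier
  g y = proj₁ (surjective y)
  f-g : ∀ y → f (g y) B.≈ y
  f-g y = proj₂ (surjective y) A.refl

-- Restriction to unions of components, and direct products.

module Restrictions {n : ℕ} {G : Graph n} (setting : Setting G) where

  open Components setting

  groupOf : Subgroup → Group 0ℓ 0ℓ
  groupOf H = record
    { Carrier = ∃ mem
    ; _≈_ = λ (g , _) (h , _) → g ≈ h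
    ; _∙_ = λ (g , m) (h , m′) → g ∙ h , ∙-mem m m′
    ; ε = ε , ε-mem
    ; _⁻¹ = λ (g , m) → g ⁻¹ , ⁻¹-mem m
    ; isGroup = record
      { isMonoid = record
        { isSemigroup = record
          { isMagma = record
            { isEquivalence = record
              { refl = λ _ → refl ; sym = λ p v → sym (p v) ; trans = λ p q v → trans (p v) (q v) }
            ; ∙-cong = λ {(g , _)} {(g′ , _)} p q v → trans (cong (g ·_) (q v)) (p _) }
          ; assoc = λ _ _ _ _ → refl }
        ; identity = (λ _ _ → refl) , (λ _ _ → refl) }
      ; inverse = (λ (g , _) → cancelˡ g) , (λ (g , _) → cancelʳ g)
      ; ⁻¹-cong = λ {(g , _)} {(h , _)} → ⁻¹-cong g h } }
    where open Subgroup H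

  ΓG : {S : Fin n → Set} → Decidable S → Group 0ℓ 0ℓ
  ΓG S? = groupOf (supported S?)

  -- `T-closed` makes `T` a union of components of the graph induced on `R`. By `component-stable`,
  -- automorphisms supported on `R` preserve `T`, so they can be cut down to `T` and extended by the
  -- identity.
  module Restriction {R : Fin n → Set} (R? : Decidable R) {T : Fin n → Set} (T? : Decidable T)
    (T⊆R : ∀ {v} → T v → R v) (T-closed : ∀ {u w} → T u → adj G u w ≡ true → R w → T w) where

    open Subgroup (supported R?)

    T-inv : ∀ {k} → mem k → ∀ {v} → T v → T (k · v)
    T-inv {k} m t = reach-closed T-closed t (component-stable R? {k} m (T⊆R t))

    cut : Auto G → Fin n → Fin n
    cut k v with T? v
    ... | yes _ = k · v
    ... | no _  = v

    cut-in : ∀ k {v} → T v → cut k v ≡ k · v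
    cut-in k {v} t with T? v
    ... | yes _ = refl
    ... | no ¬t = ⊥-elim (¬t t)

    cut-out : ∀ k {v} → ¬ T v → cut k v ≡ v
    cut-out k {v} ¬t with T? v
    ... | yes t = ⊥-elim (¬t t)
    ... | no _  = refl

    by-cases : ∀ (f g : Fin n → Fin n) → (∀ {v} → T v → f v ≡ g v) → (∀ {v} → ¬ T v → f v ≡ g v) →
               ∀ v → f v ≡ g v
    by-cases f g yes-case no-case v with T? v
    ... | yes t = yes-case t
    ... | no ¬t = no-case ¬t

    cut-∙ : ∀ g {h} → mem h → ∀ v → cut (g ∙ h) v ≡ cut g (cut h v)
    cut-∙ g {h} m = by-cases _ _
      (λ t → trans (cut-in (g ∙ h) t)
          (sym (trans (cong (cut g) (cut-in h t)) (cut-in g (T-inv {h} m t)))))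
      (λ ¬t → trans (cut-out (g ∙ h) ¬t) (sym (trans (cong (cut g) (cut-out h ¬t)) (cut-out g ¬t))))

    cut-cong : ∀ {g h} → (∀ {v} → T v → g · v ≡ h · v) → ∀ v → cut g v ≡ cut h v
    cut-cong {g} {h} eq = by-cases _ _
      (λ t → trans (cut-in g t) (trans (eq t) (sym (cut-in h t))))
      (λ ¬t → trans (cut-out g ¬t) (sym (cut-out h ¬t)))

    cut-ε : ∀ v → cut ε v ≡ v
    cut-ε = by-cases _ _ (cut-in ε) (cut-out ε)

    nonadjacent : ∀ {u v} → T u → R v → ¬ T v → adj G u v ≡ false
    nonadjacent {u} {v} t r ¬t with adj G u v in e
    ... | true  = ⊥-elim (¬t (T-closed t e r))
    ... | false = refl

    -- If `v` lies outside `R`, it is fixed by `k`; otherwise `T-closed` leaves no edge from `T` to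
    -- `v`.
    boundary-adj : ∀ {k} → mem k → ∀ {u v} → T u → ¬ T v → adj G (k · u) v ≡ adj G u v
    boundary-adj {k} m {u} {v} t ¬t with R? v
    ... | no ¬r = trans (cong (adj G (k · u)) (sym (m v ¬r))) (preserve k u v)
    ... | yes r = trans (nonadjacent (T-inv {k} m t) r ¬t) (sym (nonadjacent t r ¬t))

    cut-adj : ∀ {k} → mem k → ∀ u v → adj G (cut k u) (cut k v) ≡ adj G u v
    cut-adj {k} m u v with T? u | T? v
    ... | yes t | yes t′ = preserve k u v
    ... | no _  | no _   = refl
    ... | yes t | no ¬t′ = boundary-adj {k} m t ¬t′
    ... | no ¬t | yes t′ =
      trans (Graph.sym G u (k · v)) (trans (boundary-adj {k} m t′ ¬t) (Graph.sym G v u))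

    restrict : ∃ mem → Group.Carrier (ΓG T?)
    restrict (k , m) = record
      { perm = permutation (cut k) (cut (k ⁻¹))
          (λ v → trans (sym (cut-∙ k {k ⁻¹} (⁻¹-mem {k} m) v))
              (trans (cut-cong {k ∙ k ⁻¹} {ε} (λ {v} _ → cancelʳ k v) v) (cut-ε v)))
          (λ v → trans (sym (cut-∙ (k ⁻¹) {k} m v))
              (trans (cut-cong {k ⁻¹ ∙ k} {ε} (λ {v} _ → cancelˡ k v) v) (cut-ε v)))
      ; preserve = cut-adj {k} m } , λ v → cut-out k

  -- Both `C` and its complement in `S` are unions of components. An automorphism is determined by
  -- its two restrictions, and a pair of them is realised by its product.
  directProduct : ∀ {S : Fin n → Set} (S? : Decidable S) {C : Fin n → Set} (C? : Decidable C) →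
    (∀ {v} → C v → S v) → (∀ {u w} → C u → adj G u w ≡ true → S w → C w) →
    DP.group (ΓG C?) (ΓG (λ v → S? v ×-dec ¬? (C? v))) ≅ ΓG S?
  directProduct {S} S? {C} C? C⊆S C-closed = ≅-sym {ΓG S?} {DP.group (ΓG C?) (ΓG D?)}
    (bijectiveHomomorphism (ΓG S?) (DP.group (ΓG C?) (ΓG D?))
      (λ g → RC.restrict g , RD.restrict g)
      (λ {(g , _)} {(h , _)} eq → RC.cut-cong {g} {h} (λ {v} _ → eq v) , RD.cut-cong {g} {h}
          (λ {v} _ → eq v))
      (λ (g , _) (h , m) → RC.cut-∙ g {h} m , RD.cut-∙ g {h} m)
      (λ {(g , m)} {(h , m′)} (p , q) v → injective g m h m′ p q v)
      (λ ((g , m) , (h , m′)) → (g ∙ h , λ v ¬s → trans (cong (g ·_) (m′ v λ (s , _) → ¬s s))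
          (m v λ c → ¬s (C⊆S c)))
        , RC.by-cases _ _ (λ c → trans (RC.cut-in (g ∙ h) c) (cong (g ·_) (m′ _ λ (_ , ¬c) → ¬c c)))
            (λ {v} ¬c → trans (RC.cut-out (g ∙ h) ¬c) (sym (m v ¬c)))
        , RD.by-cases _ _ (λ d → trans (RD.cut-in (g ∙ h) d)
                             (m _ λ c → proj₂ (supported-inv D? {h} m′ d) c))
            (λ {v} ¬d → trans (RD.cut-out (g ∙ h) ¬d) (sym (m′ v ¬d)))))
    where
    D : Fin n → Set
    D v = S v × ¬ C v
    D? : Decidable D
    D? v = S? v ×-dec ¬? (C? v)
    module RC = Restriction S? C? C⊆S C-closed
    D-closed : ∀ {u w} → D u → adj G u w ≡ true → S w → D w
    D-closed (su , ¬cu) e sw = sw , λ cw → ¬cu (C-closed cw (adj-sym {G = G} e) su)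
    module RD = Restriction S? D? proj₁ D-closed
    injective : ∀ g → Subgroup.mem (supported S?) g → ∀ h → Subgroup.mem (supported S?) h →
                (∀ v → RC.cut g v ≡ RC.cut h v) → (∀ v → RD.cut g v ≡ RD.cut h v) → g ≈ h
    injective g m h m′ p q v with S? v | C? v
    ... | no ¬s | _     = trans (m v ¬s) (sym (m′ v ¬s))
    ... | yes s | yes c = trans (sym (RC.cut-in g c)) (trans (p v) (RC.cut-in h c))
    ... | yes s | no ¬c = trans (sym (RD.cut-in g (s , ¬c))) (trans (q v) (RD.cut-in h (s , ¬c)))

  product-of : ∀ {k} → (Fin k → Auto G) → Auto G
  product-of {zero}  φ = ε
  product-of {suc k} φ = φ zero ∙ product-of (φ ∘ suc)

  product-fixed : ∀ {k} (φ : Fin k → Auto G) {v} → (∀ j → φ j · v ≡ v) → product-of φ · v ≡ v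
  product-fixed {zero}  φ fix = refl
  product-fixed {suc k} φ fix = trans (cong (φ zero ·_) (product-fixed (φ ∘ suc) (fix ∘ suc)))
      (fix zero)

  -- Meant for factors with disjoint supports: `fix` serves the factors applied before `φ i`, and
  -- `fix′` those applied after it.
  product-single : ∀ {k} (φ : Fin k → Auto G) i {v} → (∀ j → j ≢ i → φ j · v ≡ v) →
    (∀ j → j ≢ i → φ j · φ i · v ≡ φ i · v) → product-of φ · v ≡ φ i · v
  product-single φ zero fix fix′ = cong (φ zero ·_) (product-fixed (φ ∘ suc) λ j → fix (suc j) λ ())
  product-single φ (suc i) fix fix′ = trans
    (cong (φ zero ·_) (product-single (φ ∘ suc) i (λ j j≢i → fix (suc j) (j≢i ∘ suc-injective))
      (λ j j≢i → fix′ (suc j) (j≢i ∘ suc-injective))))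
    (fix′ zero λ ())

  product-mem : ∀ H {k} (φ : Fin k → Auto G) → (∀ j → Subgroup.mem H (φ j)) → Subgroup.mem H
      (product-of φ)
  product-mem H {zero}  φ m = Subgroup.ε-mem H
  product-mem H {suc k} φ m = Subgroup.∙-mem H (m zero) (product-mem H (φ ∘ suc) (m ∘ suc))

-- The wreath product decomposition.

-- The points of the wreath product are the elements γ i · b of the orbit of b, and its
-- top group is H modulo the stabiliser of b, that is, H with a coarser equality.
module Wreathing {n : ℕ} {G : Graph n} (setting : Setting G) {S : Fin n → Set} (S? : Decidable S)
  (S-conn : GroupAction.Connected G S) (b : Fin n) (b∈S : S b)
  (ρ : Components.SupportRetraction setting S? S-conn b b∈S) where

  open Components setting
  open Restrictions setting
  open Residual setting (supported S?) S S? (λ {h} → supported-inv S? {h}) S-conn (λ m → m) b b∈S ρ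

  -- `γ` lists coset representatives of the stabiliser of `b`. By `T-covers` and `T-unique`, `Rest`
  -- is the disjoint union of the translates of `T` by the `γ i`.
  module Translates
    {k : ℕ} (γ : Fin k → Auto G) (γ∈H : ∀ i → Subgroup.mem (supported S?) (γ i))
    (γ-injective : ∀ {i j} → γ i · b ≡ γ j · b → i ≡ j)
    (γ-covers : ∀ {g} → Subgroup.mem (supported S?) g → ∃ λ i → γ i · b ≡ g · b)
    {T : Fin n → Set} (T? : Decidable T) (T⊆Rest : ∀ {v} → T v → Rest v)
    (T-closed : ∀ {u w} → T u → adj G u w ≡ true → Rest w → T w)
    (T-covers : ∀ {v} → Rest v → ∃ λ g → Subgroup.mem (supported S?) g × T (g · v))
    (T-unique : ∀ {g v} → Subgroup.mem (supported S?) g → T v → T (g · v) → g · b ≡ b)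
    where

    H : Subgroup
    H = supported S?

    open Subgroup H
    open Restriction Rest? T? T⊆Rest T-closed

    Φ : Group 0ℓ 0ℓ
    Φ = record
      { Carrier = ∃ mem
      ; _≈_ = λ (g , _) (h , _) → g · b ≡ h · b
      ; _∙_ = λ (g , m) (h , m′) → g ∙ h , ∙-mem {g} {h} m m′
      ; ε = ε , ε-mem
      ; _⁻¹ = λ (g , m) → g ⁻¹ , ⁻¹-mem {g} m
      ; isGroup = record
        { isMonoid = record
          { isSemigroup = record
            { isMagma = record
              { isEquivalence = record { refl = refl ; sym = sym ; trans = trans }
              ; ∙-cong = λ {(g , m)} {(g′ , m′)} {(h , l)} {(h′ , l′)} p q →
                  trans (cong (g ·_) q) (agree {g} {g′} {ε} {h′} m m′ ε-mem l′ p) }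
            ; assoc = λ _ _ _ → refl }
          ; identity = (λ _ → refl) , (λ _ → refl) }
        ; inverse = (λ (g , _) → cancelˡ g b) , (λ (g , _) → cancelʳ g b)
        ; ⁻¹-cong = λ {(g , m)} {(h , l)} p → sym (trans (sym (cancelˡ g _)) (cong (g ⁻¹ ·_)
            (trans (agree {g} {h} {ε} {h ⁻¹} m l ε-mem (⁻¹-mem {h} l) p) (cancelʳ h b)))) } }

    Φ-commutative : Commutative (Group._≈_ Φ) (Group._∙_ Φ)
    Φ-commutative (g , m) (h , m′) = abelian-orbit {g} {h} m m′

    opaque
      act : Auto G → Fin k → Fin k
      act g i with all? (λ v → ¬? (S? v) →-dec (g · v ≟ v))
      ... | yes m = proj₁ (γ-covers {g ∙ γ i} (∙-mem {g} {γ i} m (γ∈H i)))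
      -- A default value outside `H`; it lets `act` depend on `g` alone and not on a proof of
      -- membership.
      ... | no _  = i

      γ-act : ∀ {g} → mem g → ∀ i → γ (act g i) · b ≡ g · γ i · b
      γ-act {g} m i with all? (λ v → ¬? (S? v) →-dec (g · v ≟ v))
      ... | yes m′ = proj₂ (γ-covers {g ∙ γ i} (∙-mem {g} {γ i} m′ (γ∈H i)))
      ... | no ¬m  = ⊥-elim (¬m m)

    act-cong : ∀ {g h} → mem g → mem h → g · b ≡ h · b → ∀ i → act g i ≡ act h i
    act-cong {g} {h} m l eq i = γ-injective (trans (γ-act {g} m i)
      (trans (agree {g} {h} {ε} {γ i} m l ε-mem (γ∈H i) eq) (sym (γ-act {h} l i))))

    act-∙ : ∀ {g h} → mem g → mem h → ∀ i → act (g ∙ h) i ≡ act g (act h i)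
    act-∙ {g} {h} m l i = γ-injective (trans (γ-act {g ∙ h} (∙-mem {g} {h} m l) i)
      (sym (trans (γ-act {g} m _) (cong (g ·_) (γ-act {h} l i)))))

    act-ε : ∀ i → act ε i ≡ i
    act-ε i = γ-injective (γ-act {ε} ε-mem i)

    action : PermAction Φ (Fin k)
    action = record
      { act      = λ (g , _) → act g
      ; act-cong = λ {(g , m)} {(h , l)} → act-cong {g} {h} m l
      ; act-ε    = act-ε
      ; act-∙    = λ (g , m) (h , l) → act-∙ {g} {h} m l
      ; faithful = λ {(g , m)} {(h , l)} eq → let (i , γib) = γ-covers {ε} ε-mem in
          trans (cong (g ·_) (sym γib)) (trans (sym (γ-act {g} m i))
              (trans (cong (λ j → γ j · b) (eq i))
            (trans (γ-act {h} l i) (cong (h ·_) γib)))) }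

    W : Group 0ℓ 0ℓ
    W = Wreath (ΓG T?) Φ (Fin k) action

    -- The action of g from the i′-th translate of T to the i-th, with both translates
    -- identified with T.
    κ : Auto G → Fin k → Auto G
    κ g i = γ i ⁻¹ ∙ (g ∙ γ (act (g ⁻¹) i))

    κ∈Stab : ∀ {g} → mem g → ∀ i → Subgroup.mem Stab (κ g i)
    κ∈Stab {g} m i = ∙-mem {γ i ⁻¹} {g ∙ γ (act (g ⁻¹) i)} (⁻¹-mem {γ i} (γ∈H i))
        (∙-mem {g} {γ (act (g ⁻¹) i)} m (γ∈H _))
      , trans (cong (λ v → γ i ⁻¹ · g · v) (γ-act {g ⁻¹} (⁻¹-mem {g} m) i))
          (trans (cong (γ i ⁻¹ ·_) (cancelʳ g _)) (cancelˡ (γ i) b))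

    κ∈Rest : ∀ {g} → mem g → ∀ i → Subgroup.mem (supported Rest?) (κ g i)
    κ∈Rest {g} m i = K-supported {κ g i} (κ∈Stab {g} m i)

    δ : ∃ mem → Fin k → Group.Carrier (ΓG T?)
    δ (g , m) i = restrict (κ g i , κ∈Rest {g} m i)

    -- The representative `γ i` of the coset of `g ⁻¹` differs from `g ⁻¹` by an element of `Stab`,
    -- which preserves `T`.
    decompose : ∀ {v} → Rest v → ∃ λ i → ∃ λ t → T t × v ≡ γ i · t
    decompose {v} r with T-covers r
    ... | g , m , t with γ-covers {g ⁻¹} (⁻¹-mem {g} m)
    ...   | i , eq = i , γ i ⁻¹ · v , subst (λ z → T (γ i ⁻¹ · z)) (cancelˡ g v)
        (T-inv {q} (K-supported {q} (∙-mem {γ i ⁻¹} {g ⁻¹} (⁻¹-mem {γ i} (γ∈H i)) (⁻¹-mem {g} m) ,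
            transpose (γ i) eq)) t)
      , sym (cancelʳ (γ i) v)
      where
      q : Auto G
      q = γ i ⁻¹ ∙ g ⁻¹

    toWreath : ∃ mem → Group.Carrier W
    toWreath g = δ g , g

    toWreath-cong : ∀ {g h} → Group._≈_ (ΓG S?) g h → Group._≈_ W (toWreath g) (toWreath h)
    toWreath-cong {g , m} {h , l} eq = (λ i → cut-cong {κ g i} {κ h i} λ {v} _ → cong (γ i ⁻¹ ·_)
        (trans (eq _) (cong (λ j → h · γ j · v)
          (act-cong {g ⁻¹} {h ⁻¹} (⁻¹-mem {g} m) (⁻¹-mem {h} l) (⁻¹-cong g h eq b) i))))
      , eq b

    toWreath-∙ : ∀ g h → Group._≈_ W (toWreath (Group._∙_ (ΓG S?) g h))
        (Group._∙_ W (toWreath g) (toWreath h))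
    toWreath-∙ (g , m) (h , l) = (λ i v → trans
        (cut-cong {κ (g ∙ h) i} {κ g i ∙ κ h (act (g ⁻¹) i)} (λ {v} _ → split i v) v)
        (cut-∙ (κ g i) {κ h (act (g ⁻¹) i)} (κ∈Rest {h} l _) v)) , refl
      where
      -- The cocycle identity for `κ`: the inverse of `g ∙ h` acts on indices as `h ⁻¹` after
      -- `g ⁻¹`, and the intermediate representative cancels.
      split : ∀ i v → κ (g ∙ h) i · v ≡ κ g i · κ h (act (g ⁻¹) i) · v
      split i v = cong (λ z → γ i ⁻¹ · g · z) (trans
        (cong (λ j → h · γ j · v) (trans
          (act-cong {(g ∙ h) ⁻¹} {h ⁻¹ ∙ g ⁻¹} (⁻¹-mem {g ∙ h} (∙-mem {g} {h} m l))
            (∙-mem {h ⁻¹} {g ⁻¹} (⁻¹-mem {h} l) (⁻¹-mem {g} m)) refl i)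
          (act-∙ {h ⁻¹} {g ⁻¹} (⁻¹-mem {h} l) (⁻¹-mem {g} m) i)))
        (sym (cancelʳ (γ (act (g ⁻¹) i)) _)))

    act-⁻¹ : ∀ {g} → mem g → ∀ i → act (g ⁻¹) (act g i) ≡ i
    act-⁻¹ {g} m i = γ-injective (trans (γ-act {g ⁻¹} (⁻¹-mem {g} m) _)
      (trans (cong (g ⁻¹ ·_) (γ-act {g} m i)) (cancelˡ g _)))

    κ-act : ∀ {g} → mem g → ∀ i v → γ (act g i) · κ g (act g i) · v ≡ g · γ i · v
    κ-act {g} m i v = trans (cancelʳ (γ (act g i)) _) (cong (λ j → g · γ j · v) (act-⁻¹ {g} m i))

    -- Outside `S` both act trivially. On `S` outside `Rest` they agree because `h ⁻¹ ∙ g` fixes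
    -- `b`, and on `Rest` the base components determine the action on every translate.
    toWreath-injective : ∀ {g h} → Group._≈_ W (toWreath g) (toWreath h) → Group._≈_ (ΓG S?) g h
    toWreath-injective {g , m} {h , l} (p , q) v = conclude (S? v) (Rest? v)
      where
      open ≡-Reasoning
      translate : (∃ λ i → ∃ λ t → T t × v ≡ γ i · t) → g · v ≡ h · v
      translate (i , t , t∈T , v≡) = begin
        g · v                             ≡⟨ cong (g ·_) v≡ ⟩
        g · γ i · t                       ≡⟨ κ-act {g} m i t ⟨
        γ (act g i) · κ g (act g i) · t   ≡⟨ cong (γ (act g i) ·_) (cut-in (κ g (act g i)) t∈T) ⟨
        γ (act g i) · cut (κ g (act g i)) t ≡⟨ cong (γ (act g i) ·_) (p (act g i) t) ⟩
        γ (act g i) · cut (κ h (act g i)) t ≡⟨ cong (γ (act g i) ·_) (cut-in (κ h (act g i)) t∈T) ⟩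
        γ (act g i) · κ h (act g i) · t   ≡⟨ cong (λ j → γ j · κ h j · t) (act-cong {g} {h} m l q i) ⟩
        γ (act h i) · κ h (act h i) · t   ≡⟨ κ-act {h} l i t ⟩
        h · γ i · t                       ≡⟨ cong (h ·_) v≡ ⟨
        h · v                             ∎
      conclude : Dec (S v) → Dec (Rest v) → g · v ≡ h · v
      conclude (no ¬s) _       = trans (m v ¬s) (sym (l v ¬s))
      conclude (yes s) (no ¬r) = trans (sym (cancelʳ h _)) (cong (h ·_)
        (K-supported {h ⁻¹ ∙ g} (∙-mem {h ⁻¹} {g} (⁻¹-mem {h} l) m , transpose h (sym q)) v ¬r))
      conclude (yes s) (yes r) = translate (decompose r)

    -- The base group inside the automorphism group: `F i`, transported by `γ i`, acts on the `i`-th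
    -- translate of `T`, and the translates are disjoint.
    module Base (F : Fin k → Group.Carrier (ΓG T?)) where

      φ : Fin k → Auto G
      φ i = γ i ∙ (proj₁ (F i) ∙ γ i ⁻¹)

      base : Auto G
      base = product-of φ

      F-supported : ∀ i {v} → ¬ T v → proj₁ (F i) · v ≡ v
      F-supported i = proj₂ (F i) _

      φ-fixed : ∀ i {v} → ¬ T (γ i ⁻¹ · v) → φ i · v ≡ v
      φ-fixed i {v} ¬t = trans (cong (γ i ·_) (F-supported i ¬t)) (cancelʳ (γ i) v)

      base∈Stab : Subgroup.mem Stab base
      base∈Stab = product-mem Stab φ λ i →
        (λ v ¬s → φ-fixed i λ t → ¬s (subst S (cancelʳ (γ i) v)
            (supported-inv S? {γ i} (γ∈H i) (proj₁ (T⊆Rest t)))))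
        , φ-fixed i λ t → b∉Rest (subst Rest (cancelʳ (γ i) b) (Rest-inv {γ i} (γ∈H i) (T⊆Rest t)))

      base-translate : ∀ i {t} → T t → base · γ i · t ≡ γ i · proj₁ (F i) · t
      base-translate i {t} t∈T = trans (product-single φ i (λ j j≢i → other j≢i t∈T)
          (λ j j≢i → trans (cong (φ j ·_) own) (trans (other j≢i Ft∈T) (sym own)))) own
        where
        own : φ i · γ i · t ≡ γ i · proj₁ (F i) · t
        own = cong (λ z → γ i · proj₁ (F i) · z) (cancelˡ (γ i) t)
        Ft∈T : T (proj₁ (F i) · t)
        Ft∈T = supported-inv T? {proj₁ (F i)} (proj₂ (F i)) t∈T
        other : ∀ {j t} → j ≢ i → T t → φ j · γ i · t ≡ γ i · t
        other {j} {t} j≢i t∈T = φ-fixed j λ t′ → j≢i (γ-injective (sym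
          (trans (sym (cancelʳ (γ j) _)) (cong (γ j ·_)
            (T-unique {γ j ⁻¹ ∙ γ i} (∙-mem {γ j ⁻¹} {γ i} (⁻¹-mem {γ j} (γ∈H j)) (γ∈H i)) t∈T t′)))))

    toWreath-surjective : ∀ w → ∃ λ g → Group._≈_ W (toWreath g) w
    toWreath-surjective (f , x , m) = (g , g∈H) , (λ i → by-cases _ _ (inside i) (outside i)) , g·b
      where
      -- The element `x` already contributes `δ (x , m) i` to the base component at `i`; `F i`
      -- corrects it to `f i`.
      F : Fin k → Group.Carrier (ΓG T?)
      F i = Group._∙_ (ΓG T?) (f i) (Group._⁻¹ (ΓG T?) (δ (x , m) i))
      open Base F
      g : Auto G
      g = base ∙ x
      g∈H : mem g
      g∈H = ∙-mem {base} {x} (proj₁ base∈Stab) m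
      g·b : g · b ≡ x · b
      g·b = agree {base} {ε} {ε} {x} (proj₁ base∈Stab) ε-mem ε-mem m (proj₂ base∈Stab)
      outside : ∀ i {v} → ¬ T v → cut (κ g i) v ≡ proj₁ (f i) · v
      outside i {v} ¬t = trans (cut-out (κ g i) ¬t) (sym (proj₂ (f i) v ¬t))
      inside : ∀ i {t} → T t → cut (κ g i) t ≡ proj₁ (f i) · t
      inside i {t} t∈T = begin
        cut (κ g i) t                                  ≡⟨ cut-in (κ g i) t∈T ⟩
        γ i ⁻¹ · base · x · γ (act (g ⁻¹) i) · t       ≡⟨ cong (λ j → γ i ⁻¹ · base · x · γ j · t)
            same-point ⟩
        γ i ⁻¹ · base · x · γ (act (x ⁻¹) i) · t       ≡⟨ cong (λ z → γ i ⁻¹ · base · z)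
            (cancelʳ (γ i) _) ⟨
        γ i ⁻¹ · base · γ i · κ x i · t                ≡⟨ cong (γ i ⁻¹ ·_) (base-translate i κt∈T) ⟩
        γ i ⁻¹ · γ i · proj₁ (F i) · κ x i · t         ≡⟨ cancelˡ (γ i) _ ⟩
        proj₁ (F i) · κ x i · t                        ≡⟨ cong (λ z → proj₁ (F i) · z)
            (cut-in (κ x i) t∈T) ⟨
        proj₁ (F i) · proj₁ (δ (x , m) i) · t          ≡⟨ cong (proj₁ (f i) ·_)
            (cancelˡ (proj₁ (δ (x , m) i)) t) ⟩
        proj₁ (f i) · t                                ∎
        where
        open ≡-Reasoning
        κt∈T : T (κ x i · t)
        κt∈T = T-inv {κ x i} (κ∈Rest {x} m i) t∈T
        same-point : act (g ⁻¹) i ≡ act (x ⁻¹) i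
        same-point = act-cong {g ⁻¹} {x ⁻¹} (⁻¹-mem {g} g∈H) (⁻¹-mem {x} m)
          (Group.⁻¹-cong Φ {g , g∈H} {x , m} g·b) i

    wreath-≅ : W ≅ ΓG S?
    wreath-≅ = ≅-sym {ΓG S?} {W} (bijectiveHomomorphism (ΓG S?) W toWreath
      (λ {g} {h} → toWreath-cong {g} {h}) toWreath-∙ (λ {g} {h} → toWreath-injective {g} {h})
          toWreath-surjective)

-- The induction on the support.

module Decomposition {n : ℕ} {G : Graph n} (setting : Setting G) where

  open Components setting
  open Restrictions setting

  module ConnectedCase {S : Fin n → Set} (S? : Decidable S) (S-conn : Connected S) (b : Fin n)
      (b∈S : S b)
    (ρ : SupportRetraction S? S-conn b b∈S) where

    open Residual setting (supported S?) S S? (λ {h} → supported-inv S? {h}) S-conn (λ m → m) b b∈S ρ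
    open Subgroup (supported S?)

    -- Its classes are the orbits of components of `Rest`; a transversal picks a vertex in one
    -- component of each orbit.
    SameOrbit : Fin n → Fin n → Set
    SameOrbit u w = Rest u × Rest w × ∃ λ g → mem g × Reach G Rest (g · u) w

    SameOrbit? : Decidable₂ SameOrbit
    SameOrbit? u w = Rest? u ×-dec (Rest? w ×-dec search-mem (supported S?)
      (λ g≈h r → subst (λ z → Reach G Rest z w) (g≈h u) r) (λ g → reach? Rest? (g · u) w))

    SameOrbit-sym : Symmetric SameOrbit
    SameOrbit-sym {u} {w} (ru , rw , g , m , r) = rw , ru , g ⁻¹ , ⁻¹-mem {g} m ,
      subst (Reach G Rest (g ⁻¹ · w)) (cancelˡ g u)
        (reach-· (g ⁻¹) (λ {z} → Rest-inv {g ⁻¹} {z} (⁻¹-mem {g} m)) (reach-sym (Rest-inv {g} m ru) r))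

    -- Equality restricted to the orbit of `b`: a transversal lists that orbit, and its `rep-dom`
    -- supplies the coset representatives.
    Point : Fin n → Fin n → Set
    Point u v = u ≡ v × ∃ λ g → mem g × g · b ≡ u

    Point? : Decidable₂ Point
    Point? u v = (u ≟ v) ×-dec search-mem (supported S?) (λ g≈h eq → trans (sym (g≈h b)) eq)
        (λ g → g · b ≟ u)

    module _ (orbits : Transversal SameOrbit) (points : Transversal Point) where

      open Transversal orbits
      module P = Transversal points

      T : Fin n → Set
      T w = ∃ λ i → Reach G Rest (rep i) w

      T? : Decidable T
      T? w = any? λ i → reach? Rest? (rep i) w

      T⊆Rest : ∀ {w} → T w → Rest w
      T⊆Rest (i , r) = reach-end (proj₁ (rep-dom i)) r

      T-closed : ∀ {u w} → T u → adj G u w ≡ true → Rest w → T w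
      T-closed (i , r) e rw = i , reach-trans r (step e rw here)

      T-covers : ∀ {v} → Rest v → ∃ λ g → mem g × T (g · v)
      T-covers {v} r =
        let (i , _ , _ , g , m , path) = covers v (r , r , ε , ε-mem , here) in
        g , m , i , reach-sym (Rest-inv {g} m r) path

      -- The two components lie in one orbit, so they are the same chosen one. Then `g` maps it to
      -- itself, and `component-stabiliser` applies.
      T-unique : ∀ {g v} → mem g → T v → T (g · v) → g · b ≡ b
      T-unique {g} {v} m (i , r) (j , r′) = component-stabiliser {g} m ri
        (reach-trans (subst (λ l → Reach G Rest (rep l) (g · v)) (sym i≡j) r′)
            (reach-sym (Rest-inv {g} m ri) gr))
        where
        ri : Rest (rep i)
        ri = proj₁ (rep-dom i)
        gr : Reach G Rest (g · rep i) (g · v)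
        gr = reach-· g (λ {z} → Rest-inv {g} {z} m) r
        i≡j : i ≡ j
        i≡j = rep-inj i j (ri , proj₁ (rep-dom j) , g , m ,
          reach-trans gr (reach-sym (proj₁ (rep-dom j)) r′))

      γ : Fin P.size → Auto G
      γ i = proj₁ (proj₂ (P.rep-dom i))

      γ∈H : ∀ i → mem (γ i)
      γ∈H i = proj₁ (proj₂ (proj₂ (P.rep-dom i)))

      γb : ∀ i → γ i · b ≡ P.rep i
      γb i = proj₂ (proj₂ (proj₂ (P.rep-dom i)))

      γ-injective : ∀ {i j} → γ i · b ≡ γ j · b → i ≡ j
      γ-injective {i} {j} eq =
        P.rep-inj i j (trans (sym (γb i)) (trans eq (γb j)) , γ i , γ∈H i , γb i)

      γ-covers : ∀ {g} → mem g → ∃ λ i → γ i · b ≡ g · b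
      γ-covers {g} m = let (i , eq , _) = P.covers (g · b) (refl , g , m , refl) in i , trans (γb i) (sym eq)

      open Wreathing setting S? S-conn b b∈S ρ
      open Translates γ γ∈H γ-injective (λ {g} → γ-covers {g}) T? T⊆Rest T-closed T-covers
        (λ {g} {v} → T-unique {g} {v})

      reduction : RepeatedDirectWreath (ΓG T?) → RepeatedDirectWreath (ΓG S?)
      reduction Δ = iso (wreath Δ Φ Φ-commutative (Fin P.size) action) wreath-≅

  -- If the induced graph is disconnected, a component and its complement are both smaller than `S`.
  -- If it is connected, the set `T` is smaller because it omits `b`.
  repeatedDirectWreath : ∀ {S : Fin n → Set} (S? : Decidable S) → Acc _<_ (count S?) →
                         RepeatedDirectWreath (ΓG S?)
  repeatedDirectWreath {S} S? (acc rec) = nonempty (any? S?)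
    where
    module _ (v : Fin n) (v∈S : S v) where
      C : Fin n → Set
      C = Reach G S v
      C? : Decidable C
      C? = reach? S? v
      C⊆S : ∀ {w} → C w → S w
      C⊆S = reach-end v∈S
      D? : Decidable (λ w → S w × ¬ C w)
      D? w = S? w ×-dec ¬? (C? w)

      disconnected : ∀ w → S w → ¬ C w → RepeatedDirectWreath (ΓG S?)
      disconnected w s ¬c = iso
        (direct (repeatedDirectWreath C? (rec (count-< C? S? C⊆S w ¬c s)))
                (repeatedDirectWreath D? (rec (count-< D? S? proj₁ v (λ (_ , ¬c) → ¬c here) v∈S))))
        (directProduct S? C? C⊆S λ c e s → reach-trans c (step e s here))

      connected : (∀ {w} → S w → C w) → RepeatedDirectWreath (ΓG S?)
      connected S⊆C = C.reduction orbits points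
        (repeatedDirectWreath T? (rec (count-< T? S? (λ t → proj₁ (C.T⊆Rest orbits points t))
          b (λ t → b∉Rest (C.T⊆Rest orbits points t)) b∈S)))
        where
        S-conn : Connected S
        S-conn su sw = reach-trans (reach-sym v∈S (S⊆C su)) (S⊆C sw)
        top = maximalStabiliser (supported S?) S? v v∈S
        b = proj₁ top
        b∈S = proj₁ (proj₂ top)
        ρ = Maximal.maximalRetraction (supported S?) S S? (λ {h} → supported-inv S? {h}) S-conn b
            b∈S (proj₂ (proj₂ top))
        module C = ConnectedCase S? S-conn b b∈S ρ
        open Residual setting (supported S?) S S? (λ {h} → supported-inv S? {h}) S-conn (λ m → m)
            b b∈S ρ using (b∉Rest)
        orbits : Transversal C.SameOrbit
        orbits = transversal C.SameOrbit C.SameOrbit? C.SameOrbit-sym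
        points : Transversal C.Point
        points = transversal C.Point C.Point? λ { (refl , g) → refl , g }
        T? = C.T? orbits points

    nonempty : Dec (∃ S) → RepeatedDirectWreath (ΓG S?)
    nonempty (no empty) = abelian λ (g , m) (h , l) v →
      trans (trivial g m _) (trans (trivial h l v) (sym (trans (trivial h l _) (trivial g m v))))
      where
      trivial : ∀ g → Subgroup.mem (supported S?) g → ∀ v → g · v ≡ v
      trivial g m v = m v λ s → empty (v , s)
    nonempty (yes (v , v∈S)) with any? (λ w → D? v v∈S w)
    ... | yes (w , s , ¬c) = disconnected v v∈S w s ¬c
    ... | no none = connected v v∈S λ {w} s → decidable-stable (C? v v∈S w) λ ¬c → none (w , s , ¬c)

  Aut-repeatedDirectWreath : RepeatedDirectWreath (Aut G)
  Aut-repeatedDirectWreath = iso (repeatedDirectWreath {λ _ → ⊤} (λ _ → yes tt) (<-wellFounded _))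
    (bijectiveHomomorphism (ΓG {λ _ → ⊤} (λ _ → yes tt)) (Aut G) proj₁ (λ eq → eq)
        (λ _ _ _ → refl) (λ eq → eq)
      λ g → (g , λ _ ¬⊤ → ⊥-elim (¬⊤ tt)) , λ _ → refl)

-- From large prime factors to coprimality, and the theorem.

prime-divisor : ∀ {i} → NonZero i → i ≢ 1 → ∃ λ p → Prime p × p ∣ i
prime-divisor {i} nz i≢1 with factorise i {{nz}}
... | record { factors = []     ; isFactorisation = refl }                      = ⊥-elim (i≢1 refl)
... | record { factors = p ∷ ps ; isFactorisation = refl ; factorsPrime = pp ∷ _ } = p , pp , m∣m*n _

-- A common divisor other than 1 would have a prime factor that divides `m` and is at most `d`,
-- hence at most `β`.
coprime-below : ∀ {β m} → (∀ p → Prime p → p ∣ m → β < p) → ∀ d → 1 ≤ d → d ≤ β → Coprime d m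
coprime-below {β} large d@(suc _) _ d≤β {zero} (0∣d , _) with ∣⇒≤ 0∣d | 0∣⇒≡0 0∣d
... | _ | ()
coprime-below {β} large d@(suc _) _ d≤β {i@(suc _)} (i∣d , i∣m) = decidable-stable (i ≟ℕ 1) λ i≢1 →
  let (p , p-prime , p∣i) = prime-divisor {i} _ i≢1 in
  <-irrefl refl (≤-trans (large p p-prime (∣-trans p∣i i∣m)) (≤-trans (∣⇒≤ (∣-trans p∣i i∣d)) d≤β))

theorem6p4 : (α : ℕ → ℕ) → KostochkaBound α →
    (h : ℕ) → 1 ≤ h → (n : ℕ) (G : Graph n) → ¬ HasMinor (K (suc h)) G →
    (∀ m → Inverse (setoid (Fin m)) (Group.setoid (Aut G)) →
    ∀ p → Prime p → p ∣ m → α h ⊔ 2 < p) →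
    RepeatedDirectWreath (Aut G)
theorem6p4 α bound h 1≤h n G ¬minor large = Decomposition.Aut-repeatedDirectWreath {G = G} record
  { α       = α h
  ; sparse  = noDenseMinor α bound h 1≤h G ¬minor
  ; coprime = λ d 1≤d d≤α → coprime-below large′ d 1≤d (≤-trans d≤α (m≤m⊔n (α h) 2))
  ; odd     = coprime-below large′ 2 (s≤s z≤n) (m≤n⊔m (α h) 2) }
  where
  large′ : ∀ p → Prime p → p ∣ Enumeration.order G → α h ⊔ 2 < p
  large′ = large (Enumeration.order G) (Enumeration.enumeration G)
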